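{- The following bounds hold: $$\dim_H(\mathcal{E}^{(2)}(\mathbb{Z}_3))\ge\log_3\left(\frac{1+\sqrt5}{2}\right)\approx0.438018,$$ $$\dim_H(\mathcal{E}^{(3)}(\mathbb{Z}_3))\ge\log_3\beta_1\approx0.228392,$$ where $\beta_1\approx1.28520$ is a (real) root of $\lambda^6-\lambda^5-1=0$.
   Context: $\mathbb{Z}_3$ denotes the $3$-adic integers with the $3$-adic metric ($|3|_3=1/3$), and $\dim_H$ is Hausdorff dimension with respect to it. For $k\ge1$, $\mathcal{E}^{(k)}(\mathbb{Z}_3)$ is the set of $\lambda\in\mathbb{Z}_3$ such that for at least $k$ values of $n\ge0$ the $3$-adic expansion of $2^n\lambda$ omits the digit $2$ (i.e. $2^n\lambda=\sum_{j\ge0}a_j3^j$ with all $a_j\in\{0,1\}$). -}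

module Defs where

open import Algebra.Bundles using (RawSemiring)
import Algebra.Definitions.RawSemiring as RawSemiringDefinitions
open import Data.Fin.Base using (Fin; toℕ)
open import Data.Fin.Properties using (toℕ-fromℕ<)
open import Data.Fin.Patterns using (2F)
open import Data.Integer.Base using (ℤ; +_; -[1+_]; ∣_∣)
open import Data.Nat.Base as ℕ using (ℕ; zero; suc; NonZero)
open import Data.Nat.DivMod as DivMod using (_mod_; _%_; m%n<n;
  m≡m%n+[m/n]*n; m∣n⇒o%n%m≡o%m; m%[n*o]/o≡m/o%n; [m+kn]%n≡m%n)
open import Data.Nat.Divisibility using (n∣m*n)
import Data.Nat.Properties as ℕ
open import Data.Product.Base using (Σ-syntax; ∃-syntax; _×_; _,_; proj₁)
open import Data.Rational.Base as ℚ using (ℚ; 0ℚ; 1ℚ; _/_; ↥_; ↧ₙ_)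
import Data.Rational.Properties as ℚ
open import Data.Sum.Base using (_⊎_)
open import Data.Unit.Base using (⊤)
open import Function.Bundles using (_↣_; Injection)
open import Level using (Level; Lift; 0ℓ; _⊔_) renaming (suc to lsuc)
open import Relation.Binary.PropositionalEquality using (_≡_; _≢_; sym; cong; cong₂; module ≡-Reasoning)
open import Relation.Nullary.Negation.Core using (¬_)
open import Relation.Unary using (Pred; _∈_)

private variable
  ℓ ℓ′ ι : Level

open RawSemiringDefinitions ℚ.+-*-rawSemiring public using (_^_)

------------------------------------------------------------------------
-- The definitions in this module have their classical meaning under
-- excluded middle.  Positive lower bounds for ℋ do need classical logic (or
-- the fan theorem): a computable presentation admits countable covers of
-- Cantor-like sets of arbitrarily small total size.

-- Extended real numbers [-∞, ∞], as open lower cuts of ℚ (classically,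
-- every such cut is {q : q < a} for a unique a).  The level
-- parameter is that of the cut: infima over all covers by subsets of ℤ₃
-- produce cuts one level up.

record ℝ̄ (ℓ : Level) : Set (lsuc ℓ) where
  field
    Below : Pred ℚ ℓ
    down  : ∀ {p q} → p ℚ.< q → Below q → Below p
    open′ : ∀ {p} → Below p → ∃[ q ] p ℚ.< q × Below q

infix 4 _⋖_ _≤_ _<_ _≈_

-- q ⋖ a : the rational q is strictly below a.
_⋖_ : ℚ → ℝ̄ ℓ → Set ℓ
q ⋖ a = ℝ̄.Below a q

_≤_ _<_ _≈_ : ℝ̄ ℓ → ℝ̄ ℓ′ → Set (ℓ ⊔ ℓ′)
a ≤ b = ∀ q → q ⋖ a → q ⋖ b
a < b = ∃[ q ] ¬ (q ⋖ a) × q ⋖ b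
a ≈ b = a ≤ b × b ≤ a

-- Least upper bound of a set of rationals (not necessarily downward
-- closed); every other extended real below is built with it.
sup : Pred ℚ ℓ → ℝ̄ ℓ
sup P = record
  { Below = λ q → ∃[ p ] q ℚ.< p × P p
  ; down  = λ { p<q (r , q<r , Pr) → r , ℚ.<-trans p<q q<r , Pr }
  ; open′ = λ { (r , p<r , Pr) → let m , p<m , m<r = ℚ.<-dense p<r in
                                 m , p<m , r , m<r , Pr }
  }

fromℚ : ℚ → ℝ̄ 0ℓ
fromℚ q = sup (_≡ q)

∞ : ℝ̄ 0ℓ
∞ = sup (λ _ → ⊤)

⨆ ⨅ : {I : Set ι} → (I → ℝ̄ ℓ) → ℝ̄ (ι ⊔ ℓ)
⨆ f = sup (λ p → ∃[ i ] p ⋖ f i)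
⨅ f = sup (λ p → ∀ i → p ⋖ f i)

infixl 6 _+_ _-_
infix  8 -_

_+_ : ℝ̄ ℓ → ℝ̄ ℓ′ → ℝ̄ (ℓ ⊔ ℓ′)
a + b = sup (λ p → ∃[ u ] ∃[ v ] u ⋖ a × v ⋖ b × p ≡ u ℚ.+ v)

-_ : ℝ̄ ℓ → ℝ̄ ℓ
- a = sup (λ p → ¬ (ℚ.- p ⋖ a))

_-_ : ℝ̄ ℓ → ℝ̄ ℓ′ → ℝ̄ (ℓ ⊔ ℓ′)
a - b = a + (- b)

half : ℝ̄ ℓ → ℝ̄ ℓ
half a = sup (λ p → p ℚ.+ p ⋖ a)

-- Square root of q ≥ 0.
√ : ℚ → ℝ̄ 0ℓ
√ q = sup (λ p → p ℚ.* p ℚ.≤ q)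

-- aⁿ for a ≥ 0.
infixr 8 _^ⁿ_
_^ⁿ_ : ℝ̄ ℓ → ℕ → ℝ̄ ℓ
a ^ⁿ n = sup (λ p → ∃[ b ] 0ℚ ℚ.≤ b × fromℚ b ≤ a × p ≡ b ^ n)

-- aˢ for a ≥ 0 and 0 < s < ∞.  For rational t = ↥t/↧t ≥ 0 and b, c ≥ 0,
-- c ≤ bᵗ means c^↧t ≤ b^↥t, and bᵗ decreases in t when b ≤ 1 but
-- increases when b ≥ 1; so t must approach s from above or from below
-- respectively.
infixr 8 _^ʳ_
_^ʳ_ : ℝ̄ ℓ → ℝ̄ ℓ′ → ℝ̄ (ℓ ⊔ ℓ′)
a ^ʳ s = sup (λ c → 0ℚ ℚ.≤ c × (∃[ b ] ∃[ t ]
    0ℚ ℚ.≤ b × fromℚ b ≤ a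
  × 0ℚ ℚ.≤ t × (b ℚ.≤ 1ℚ × s ≤ fromℚ t ⊎ 1ℚ ℚ.≤ b × fromℚ t ≤ s)
  × c ^ ↧ₙ t ℚ.≤ b ^ ∣ ↥ t ∣))

3^ : ℤ → ℚ
3^ (+ n)    = (+ 3 / 1) ^ n
3^ -[1+ n ] = (+ 1 / 3) ^ suc n

-- Logarithm of a > 0 to base 3: t ≤ log₃ b means 3^↥t ≤ b^↧t.
log₃ : ℝ̄ ℓ → ℝ̄ ℓ
log₃ a = sup (λ t → ∃[ b ] 0ℚ ℚ.< b × fromℚ b ≤ a × 3^ (↥ t) ℚ.≤ b ^ ↧ₙ t)

infix 4 _≐_±_
_≐_±_ : ℝ̄ ℓ → ℚ → ℚ → Set ℓ
a ≐ q ± ε = fromℚ (q ℚ.- ε) < a × a < fromℚ (q ℚ.+ ε)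

partialSum : (ℕ → ℝ̄ ℓ) → ℕ → ℝ̄ ℓ
partialSum {ℓ} f zero    = sup (λ p → Lift ℓ (p ≡ 0ℚ))
partialSum     f (suc n) = partialSum f n + f n

-- Sum of a series of non-negative terms.
∑ : (ℕ → ℝ̄ ℓ) → ℝ̄ ℓ
∑ f = ⨆ (partialSum f)

------------------------------------------------------------------------
-- The 3-adic integers

-- x stands for Σ_{j ≥ 0} x j · 3ʲ.
ℤ₃ : Set
ℤ₃ = ℕ → Fin 3

infixl 7 _/3^_ _%3^_

_/3^_ _%3^_ : ℕ → ℕ → ℕ
n /3^ j = DivMod._/_ n (3 ℕ.^ j) {{ℕ.m^n≢0 3 j}}
n %3^ j = _%_ n (3 ℕ.^ j) {{ℕ.m^n≢0 3 j}}

-- The residue of x modulo 3ᵏ.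
trunc : ℤ₃ → ℕ → ℕ
trunc x zero    = 0
trunc x (suc k) = trunc x k ℕ.+ toℕ (x k) ℕ.* 3 ℕ.^ k

-- Multiplication of a 3-adic integer by a natural number: digit j of the
-- product depends only on x modulo 3ʲ⁺¹.  See trunc-• below.
infixr 7 _•_
_•_ : ℕ → ℤ₃ → ℤ₃
(m • x) j = (m ℕ.* trunc x (suc j) /3^ j) mod 3

trunc-• : ∀ m x k → trunc (m • x) k ≡ m ℕ.* trunc x k %3^ k
trunc-• m x zero    = sym (cong (_%3^ 0) (ℕ.*-zeroʳ m))
trunc-• m x (suc k) = begin
  trunc (m • x) k ℕ.+ toℕ ((m • x) k) ℕ.* P  ≡⟨ cong₂ (λ t d → t ℕ.+ d ℕ.* P) (trunc-• m x k) (toℕ-fromℕ< (m%n<n (N /3^ k) 3)) ⟩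
  m ℕ.* T % P ℕ.+ N /3^ k % 3 ℕ.* P          ≡⟨ cong (ℕ._+ N /3^ k % 3 ℕ.* P) low ⟨
  N % P ℕ.+ N /3^ k % 3 ℕ.* P                ≡⟨ cong₂ (λ r d → r ℕ.+ d ℕ.* P) (m∣n⇒o%n%m≡o%m P (3 ℕ.* P) N (n∣m*n 3)) (m%[n*o]/o≡m/o%n N 3 P) ⟨
  R % P ℕ.+ R /3^ k ℕ.* P                    ≡⟨ m≡m%n+[m/n]*n R P ⟨
  R                                          ∎
  where
  open ≡-Reasoning
  P = 3 ℕ.^ k
  instance
    P≢0 : NonZero P
    P≢0 = ℕ.m^n≢0 3 k
    3P≢0 : NonZero (3 ℕ.* P)
    3P≢0 = ℕ.m^n≢0 3 (suc k)
  T = trunc x k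
  N = m ℕ.* trunc x (suc k)
  R = N % (3 ℕ.* P)
  d = toℕ (x k)
  low : N % P ≡ m ℕ.* T % P
  low = begin
    m ℕ.* (T ℕ.+ d ℕ.* P) % P            ≡⟨ cong (_% P) (ℕ.*-distribˡ-+ m T (d ℕ.* P)) ⟩
    (m ℕ.* T ℕ.+ m ℕ.* (d ℕ.* P)) % P    ≡⟨ cong (λ e → (m ℕ.* T ℕ.+ e) % P) (ℕ.*-assoc m d P) ⟨
    (m ℕ.* T ℕ.+ m ℕ.* d ℕ.* P) % P      ≡⟨ [m+kn]%n≡m%n (m ℕ.* T) (m ℕ.* d) P ⟩
    m ℕ.* T % P                          ∎

-- ∣x - y∣₃: the largest 3⁻ᵏ such that x and y differ in digit k, or 0.
dist : ℤ₃ → ℤ₃ → ℝ̄ 0ℓ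
dist x y = sup (λ p → p ≡ 0ℚ ⊎ (∃[ k ] x k ≢ y k × p ≡ (+ 1 / 3) ^ k))

-- The empty set has diameter 0.
diam : Pred ℤ₃ ℓ → ℝ̄ ℓ
diam U = sup (λ p → p ≡ 0ℚ ⊎ (∃[ x ] ∃[ y ] x ∈ U × y ∈ U × p ⋖ dist x y))

------------------------------------------------------------------------
-- Hausdorff measure and dimension in ℤ₃

record Cover (E : Pred ℤ₃ 0ℓ) (δ : ℝ̄ 0ℓ) : Set₁ where
  field
    piece  : ℕ → Pred ℤ₃ 0ℓ
    covers : ∀ {x} → x ∈ E → ∃[ i ] x ∈ piece i
    small  : ∀ i → diam (piece i) ≤ δ

ℋ[_,_] : ℝ̄ 0ℓ → ℝ̄ 0ℓ → Pred ℤ₃ 0ℓ → ℝ̄ (lsuc 0ℓ)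
ℋ[ s , δ ] E = ⨅ {I = Cover E δ} (λ C → ∑ (λ i → diam (Cover.piece C i) ^ʳ s))

ℋ : ℝ̄ 0ℓ → Pred ℤ₃ 0ℓ → ℝ̄ (lsuc 0ℓ)
ℋ s E = ⨆ {I = Σ[ δ ∈ ℝ̄ 0ℓ ] fromℚ 0ℚ < δ} (λ δ → ℋ[ s , proj₁ δ ] E)

-- Leaving out s = 0 does not change the infimum and avoids a convention
-- for 0⁰.
dimH : Pred ℤ₃ 0ℓ → ℝ̄ (lsuc 0ℓ)
dimH E = ⨅ {I = Σ[ s ∈ ℝ̄ 0ℓ ] fromℚ 0ℚ < s × s < ∞ × ℋ s E ≈ fromℚ 0ℚ} proj₁

------------------------------------------------------------------------

OmitsDigit2 : Pred ℤ₃ 0ℓ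
OmitsDigit2 x = ∀ j → x j ≢ 2F

-- At least k exponents n: an injective family of k of them.
𝓔 : ℕ → Pred ℤ₃ 0ℓ
𝓔 k x = Σ[ n ∈ Fin k ↣ ℕ ] ∀ i → OmitsDigit2 (2 ℕ.^ Injection.to n i • x)

goldenRatio : ℝ̄ 0ℓ
goldenRatio = half (fromℚ 1ℚ + √ (+ 5 / 1))

{-# OPTIONS --safe #-}

module Submission where

-- If digits 1 of a 0/1 expansion λ are at least g apart and M < 3^g has only digits 0 and 1, then
-- Mλ is a sum of non-overlapping shifts of M, so it omits the digit 2.  This applies to M = 1, 4
-- with g = 2 and to M = 1, 4, 256 with g = 6, since 4 = 11₃ and 256 = 100111₃.  The number of
-- such prefixes grows like βⁿ, where β^g = β^(g-1) + 1: a digit 0 uses one place and a digit 1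
-- uses g places.  Giving mass β^-n to a cylinder of length n that ends in no forced zeros, the
-- mass distribution principle bounds the Hausdorff dimension below by log₃ β.

open import Defs
open import Algebra.Bundles using (CommutativeRing)
import Algebra.Properties.CommutativeSemiring.Exp as Exp
open import Axiom.ExcludedMiddle using (ExcludedMiddle)
open import Data.Fin.Base using (Fin; toℕ)
open import Data.Fin.Patterns using (0F; 1F; 2F)
import Data.Fin.Properties as Fin
open import Data.Integer.Base as ℤ using (+_; -[1+_]; ∣_∣)
import Data.Integer.Properties as ℤ
open import Data.Nat.Base as ℕ using (ℕ; zero; suc; NonZero)
import Data.Nat.Coprimality as Coprime
open import Data.Nat.Divisibility using (n∣m*n)
open import Data.Nat.DivMod using (_%_; /-congʳ; +-distrib-/-∣ʳ; m*n/n≡m; m/n/o≡m/[n*o];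
  m<n⇒m/n≡0; 0/n≡0; [m+kn]%n≡m%n; m%n<n)
  renaming (_/_ to _/ℕ_)
import Data.Nat.Properties as ℕ
open import Data.Product.Base using (Σ-syntax; ∃-syntax; _×_; _,_; proj₁; proj₂)
open import Data.Rational.Base as ℚ using (ℚ; 0ℚ; 1ℚ; _/_; ↥_; ↧ₙ_)
import Data.Rational.Properties as ℚ
open import Data.Rational.Solver using (module +-*-Solver)
import Data.Rational.Unnormalised.Base as ℚᵘ
import Data.Rational.Unnormalised.Properties as ℚᵘ
open import Data.Sum.Base using (_⊎_; inj₁; inj₂; [_,_]′)
open import Data.Unit.Base using (⊤; tt)
open import Function.Base using (_∘_)
open import Function.Bundles using (mk↣)
open import Level using (Level; 0ℓ; lift; lower) renaming (suc to lsuc)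
open import Relation.Binary.Definitions using (tri<; tri≈; tri>)
open import Relation.Binary.PropositionalEquality
  using (_≡_; _≢_; refl; sym; trans; cong; cong₂; subst; subst₂; module ≡-Reasoning)
open import Relation.Nullary using (¬_; Dec; yes; no; contradiction)
open import Relation.Nullary.Decidable using (map′; decidable-stable; toWitness)
open import Relation.Unary using (Pred; _∈_; _⊆_)

open +-*-Solver using (solve; _:=_; _:+_; _:*_; _:-_; :-_; con)
open Exp (CommutativeRing.commutativeSemiring ℚ.+-*-commutativeRing)
  using (^-homo-*; ^-assocʳ; ^-distrib-*)

-- Neither β nor the exponent of the Hausdorff measure is a number whose powers can be computed:
-- both are cuts. The argument therefore runs with a rational `b` at or below the root, its
-- reciprocal `a` and a rational exponent `t`; the inequalities `3^t ≤ b` (with denominators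
-- cleared) and `1 ≤ a + a^(m+1)`, where `m = g - 1`, carry it. No measure is constructed. A cover
-- of too small total weight is refuted directly: digits are chosen one at a time so that the pieces
-- meeting the current region always weigh less than it, and the digits chosen form a sparse point
-- outside every piece. Countable covers are thus handled without compactness; excluded middle
-- chooses the digit and decides which pieces meet a region.

private variable
  ℓ ℓ′ ℓ″ : Level
  x y c d : ℚ

-- Rational inequalities and powers

-- Inequalities are mostly proved by exhibiting the difference of the two sides.

p≤p+q : 0ℚ ℚ.≤ d → x ℚ.+ d ≡ y → x ℚ.≤ y
p≤p+q {d} {x} 0≤d refl = subst (ℚ._≤ x ℚ.+ d) (ℚ.+-identityʳ x) (ℚ.+-monoʳ-≤ x 0≤d)

p<p+q : 0ℚ ℚ.< d → x ℚ.+ d ≡ y → x ℚ.< y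
p<p+q {d} {x} 0<d refl = subst (ℚ._< x ℚ.+ d) (ℚ.+-identityʳ x) (ℚ.+-monoʳ-< x 0<d)

p-q<p : ∀ p → 0ℚ ℚ.< d → p ℚ.- d ℚ.< p
p-q<p {d} p 0<d = p<p+q 0<d (solve 2 (λ p d → p :- d :+ d := p) refl p d)

0≤q-p : x ℚ.≤ y → 0ℚ ℚ.≤ y ℚ.- x
0≤q-p {x} {y} x≤y = subst (ℚ._≤ y ℚ.- x) (ℚ.+-inverseʳ x) (ℚ.+-monoˡ-≤ (ℚ.- x) x≤y)

0<q-p : x ℚ.< y → 0ℚ ℚ.< y ℚ.- x
0<q-p {x} {y} x<y = subst (ℚ._< y ℚ.- x) (ℚ.+-inverseʳ x) (ℚ.+-monoˡ-< (ℚ.- x) x<y)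

0≤p+q : 0ℚ ℚ.≤ x → 0ℚ ℚ.≤ y → 0ℚ ℚ.≤ x ℚ.+ y
0≤p+q = ℚ.+-mono-≤

0≤p*q : 0ℚ ℚ.≤ x → 0ℚ ℚ.≤ y → 0ℚ ℚ.≤ x ℚ.* y
0≤p*q {x} {y} 0≤x 0≤y = subst (ℚ._≤ x ℚ.* y) (ℚ.*-zeroʳ x)
  (ℚ.*-monoˡ-≤-nonNeg x {{ℚ.nonNegative 0≤x}} 0≤y)

0<p*q : 0ℚ ℚ.< x → 0ℚ ℚ.< y → 0ℚ ℚ.< x ℚ.* y
0<p*q {x} {y} 0<x 0<y = subst (ℚ._< x ℚ.* y) (ℚ.*-zeroʳ x)
  (ℚ.*-monoʳ-<-pos x {{ℚ.positive 0<x}} 0<y)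

*-mono-≤ : 0ℚ ℚ.≤ x → x ℚ.≤ y → 0ℚ ℚ.≤ c → c ℚ.≤ d → x ℚ.* c ℚ.≤ y ℚ.* d
*-mono-≤ {x} {y} {c} 0≤x x≤y 0≤c c≤d = ℚ.≤-trans
  (ℚ.*-monoʳ-≤-nonNeg c {{ℚ.nonNegative 0≤c}} x≤y)
  (ℚ.*-monoˡ-≤-nonNeg y {{ℚ.nonNegative (ℚ.≤-trans 0≤x x≤y)}} c≤d)

0≤1 : 0ℚ ℚ.≤ 1ℚ
0≤1 = ℚ.nonNegative⁻¹ 1ℚ

0<1 : 0ℚ ℚ.< 1ℚ
0<1 = ℚ.positive⁻¹ 1ℚ

0≤^ : ∀ n → 0ℚ ℚ.≤ x → 0ℚ ℚ.≤ x ^ n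
0≤^ zero    0≤x = 0≤1
0≤^ (suc n) 0≤x = 0≤p*q 0≤x (0≤^ n 0≤x)

0<^ : ∀ n → 0ℚ ℚ.< x → 0ℚ ℚ.< x ^ n
0<^ zero    0<x = 0<1
0<^ (suc n) 0<x = 0<p*q 0<x (0<^ n 0<x)

^-mono-≤ : ∀ n → 0ℚ ℚ.≤ x → x ℚ.≤ y → x ^ n ℚ.≤ y ^ n
^-mono-≤ zero    0≤x x≤y = ℚ.≤-refl
^-mono-≤ (suc n) 0≤x x≤y = *-mono-≤ 0≤x x≤y (0≤^ n 0≤x) (^-mono-≤ n 0≤x x≤y)

^-mono-< : ∀ n → 0ℚ ℚ.≤ x → x ℚ.< y → x ^ suc n ℚ.< y ^ suc n
^-mono-< {x} {y} n 0≤x x<y = ℚ.≤-<-trans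
  (ℚ.*-monoˡ-≤-nonNeg x {{ℚ.nonNegative 0≤x}} (^-mono-≤ n 0≤x (ℚ.<⇒≤ x<y)))
  (ℚ.*-monoˡ-<-pos (y ^ n) {{ℚ.positive (0<^ n (ℚ.≤-<-trans 0≤x x<y))}} x<y)

1^ : ∀ n → 1ℚ ^ n ≡ 1ℚ
1^ zero    = refl
1^ (suc n) = trans (ℚ.*-identityˡ _) (1^ n)

^≤1 : ∀ n → 0ℚ ℚ.≤ x → x ℚ.≤ 1ℚ → x ^ n ℚ.≤ 1ℚ
^≤1 {x} n 0≤x x≤1 = subst (x ^ n ℚ.≤_) (1^ n) (^-mono-≤ n 0≤x x≤1)

1≤^ : ∀ n → 1ℚ ℚ.≤ x → 1ℚ ℚ.≤ x ^ n
1≤^ {x} n 1≤x = subst (ℚ._≤ x ^ n) (1^ n) (^-mono-≤ n 0≤1 1≤x)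

^-antitone : ∀ {m n} → 0ℚ ℚ.≤ x → x ℚ.≤ 1ℚ → m ℕ.≤ n → x ^ n ℚ.≤ x ^ m
^-antitone {x} {m} {n} 0≤x x≤1 m≤n = begin
  x ^ n                        ≡⟨ cong (x ^_) (ℕ.m+[n∸m]≡n m≤n) ⟨
  x ^ (m ℕ.+ (n ℕ.∸ m))        ≡⟨ ^-homo-* x m (n ℕ.∸ m) ⟩
  x ^ m ℚ.* x ^ (n ℕ.∸ m)      ≤⟨ ℚ.*-monoˡ-≤-nonNeg (x ^ m) {{ℚ.nonNegative (0≤^ m 0≤x)}} (^≤1 (n ℕ.∸ m) 0≤x x≤1) ⟩
  x ^ m ℚ.* 1ℚ                 ≡⟨ ℚ.*-identityʳ _ ⟩
  x ^ m                        ∎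
  where open ℚ.≤-Reasoning

^-swap : ∀ x m n → (x ^ m) ^ n ≡ (x ^ n) ^ m
^-swap x m n = begin
  (x ^ m) ^ n   ≡⟨ ^-assocʳ x m n ⟩
  x ^ (m ℕ.* n) ≡⟨ cong (x ^_) (ℕ.*-comm m n) ⟩
  x ^ (n ℕ.* m) ≡⟨ ^-assocʳ x n m ⟨
  (x ^ n) ^ m   ∎
  where open ≡-Reasoning

-- Naturals as rationals, limits of powers, Lipschitz bounds

-- Built from the constructor rather than with `_/_`, so that no gcd blocks reduction when `n` is a
-- variable.
ι : ℕ → ℚ
ι n = ℚ.mkℚ (+ n) 0 (Coprime.sym (Coprime.1-coprimeTo n))

ι-+ : ∀ m n → ι (m ℕ.+ n) ≡ ι m ℚ.+ ι n
ι-+ m n = ℚ.toℚᵘ-injective (ℚᵘ.≃-sym (ℚᵘ.≃-trans (ℚ.toℚᵘ-homo-+ (ι m) (ι n))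
  (ℚᵘ.≃-reflexive (cong₂ (λ i j → ℚᵘ.mkℚᵘ (i ℤ.+ j) 0) (ℤ.*-identityʳ (+ m)) (ℤ.*-identityʳ (+ n))))))

ι-* : ∀ m n → ι (m ℕ.* n) ≡ ι m ℚ.* ι n
ι-* m n = ℚ.toℚᵘ-injective (ℚᵘ.≃-sym (ℚᵘ.≃-trans (ℚ.toℚᵘ-homo-* (ι m) (ι n))
  (ℚᵘ.≃-reflexive (cong (λ i → ℚᵘ.mkℚᵘ i 0) (sym (ℤ.pos-* m n))))))

ι-^ : ∀ m n → ι (m ℕ.^ n) ≡ ι m ^ n
ι-^ m zero    = refl
ι-^ m (suc n) = trans (ι-* m (m ℕ.^ n)) (cong (ι m ℚ.*_) (ι-^ m n))

ι-mono-≤ : ∀ {m n} → m ℕ.≤ n → ι m ℚ.≤ ι n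
ι-mono-≤ m≤n = ℚ.*≤* (ℤ.*-monoʳ-≤-nonNeg (+ 1) (ℤ.+≤+ m≤n))

ι-mono-< : ∀ {m n} → m ℕ.< n → ι m ℚ.< ι n
ι-mono-< m<n = ℚ.*<* (ℤ.*-monoʳ-<-pos (+ 1) (ℤ.+<+ m<n))

0≤ι : ∀ n → 0ℚ ℚ.≤ ι n
0≤ι n = ι-mono-≤ ℕ.z≤n

q*↧q≡∣↥q∣ : 0ℚ ℚ.≤ x → x ℚ.* ι (↧ₙ x) ≡ ι ∣ ↥ x ∣
q*↧q≡∣↥q∣ {x@(ℚ.mkℚ (+ n) d-1 _)} 0≤x = ℚ.toℚᵘ-injective (ℚᵘ.≃-trans (ℚ.toℚᵘ-homo-* x (ι (suc d-1)))
  (ℚᵘ.*≡* (ℤ.*-assoc (+ n) (+ suc d-1) (+ 1))))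
q*↧q≡∣↥q∣ {ℚ.mkℚ -[1+ _ ] _ _} (ℚ.*≤* ())

archimedean : 0ℚ ℚ.< x → ∃[ n ] 1ℚ ℚ.< ι n ℚ.* x
archimedean {x@(ℚ.mkℚ (+ suc n) _ _)} 0<x = suc (↧ₙ x) , (begin-strict
  1ℚ                              ≡⟨ ℚ.+-identityˡ 1ℚ ⟨
  0ℚ ℚ.+ ι 1                      <⟨ ℚ.+-mono-<-≤ 0<x (ι-mono-≤ {1} {suc n} (ℕ.s≤s ℕ.z≤n)) ⟩
  x ℚ.+ ι (suc n)                 ≡⟨ cong (x ℚ.+_) (q*↧q≡∣↥q∣ (ℚ.<⇒≤ 0<x)) ⟨
  x ℚ.+ x ℚ.* ι (↧ₙ x)            ≡⟨ solve 2 (λ x d → x :+ x :* d := (con 1ℚ :+ d) :* x) refl x (ι (↧ₙ x)) ⟩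
  (ι 1 ℚ.+ ι (↧ₙ x)) ℚ.* x        ≡⟨ cong (ℚ._* x) (ι-+ 1 (↧ₙ x)) ⟨
  ι (suc (↧ₙ x)) ℚ.* x            ∎)
  where open ℚ.≤-Reasoning
archimedean {ℚ.mkℚ (+ zero) _ _} (ℚ.*<* (ℤ.+<+ ()))
archimedean {ℚ.mkℚ -[1+ _ ] _ _} (ℚ.*<* ())

-- Each of the `n` terms of `1 - xⁿ = (1 - x)(1 + x + ... + xⁿ⁻¹)` is at least `xⁿ(1 - x)`. In this
-- division-free form it serves to show that `xⁿ` tends to 0.
bernoulli : ∀ n → 0ℚ ℚ.≤ x → x ℚ.≤ 1ℚ → ι n ℚ.* (x ^ n ℚ.* (1ℚ ℚ.- x)) ℚ.+ x ^ n ℚ.≤ 1ℚ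
bernoulli {x} zero    0≤x x≤1 = ℚ.≤-reflexive
  (solve 1 (λ x → con 0ℚ :* (con 1ℚ :* (con 1ℚ :- x)) :+ con 1ℚ := con 1ℚ) refl x)
bernoulli {x} (suc n) 0≤x x≤1 = p≤p+q
  (0≤p+q (0≤p*q 0≤x (0≤q-p (bernoulli n 0≤x x≤1)))
    (0≤p*q (0≤q-p (^≤1 (suc n) 0≤x x≤1)) (0≤q-p x≤1)))
  (trans (cong (λ k → k ℚ.* (x ^ suc n ℚ.* (1ℚ ℚ.- x)) ℚ.+ x ^ suc n ℚ.+ gap) (ι-+ 1 n))
    (solve 3 (λ x k X → (con 1ℚ :+ k) :* (x :* X :* (con 1ℚ :- x)) :+ x :* X
        :+ (x :* (con 1ℚ :- (k :* (X :* (con 1ℚ :- x)) :+ X)) :+ (con 1ℚ :- x :* X) :* (con 1ℚ :- x))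
      := con 1ℚ) refl x (ι n) (x ^ n)))
  where
  gap = x ℚ.* (1ℚ ℚ.- (ι n ℚ.* (x ^ n ℚ.* (1ℚ ℚ.- x)) ℚ.+ x ^ n)) ℚ.+ (1ℚ ℚ.- x ^ suc n) ℚ.* (1ℚ ℚ.- x)

^-limit : 0ℚ ℚ.≤ x → x ℚ.< 1ℚ → 0ℚ ℚ.< y → ∃[ n ] x ^ n ℚ.< y
^-limit {x} {y} 0≤x x<1 0<y with n , 1<ny ← archimedean (0<p*q 0<y (0<q-p x<1)) =
  n , ℚ.≰⇒> λ y≤xⁿ → ℚ.<-irrefl refl (begin-strict
    1ℚ                                          <⟨ 1<ny ⟩
    ι n ℚ.* (y ℚ.* (1ℚ ℚ.- x))                  ≤⟨ ℚ.*-monoˡ-≤-nonNeg (ι n) {{ℚ.nonNegative (0≤ι n)}}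
                                                    (ℚ.*-monoʳ-≤-nonNeg (1ℚ ℚ.- x) {{ℚ.nonNegative (0≤q-p (ℚ.<⇒≤ x<1))}} y≤xⁿ) ⟩
    ι n ℚ.* (x ^ n ℚ.* (1ℚ ℚ.- x))              ≤⟨ p≤p+q (0≤^ n 0≤x) refl ⟩
    ι n ℚ.* (x ^ n ℚ.* (1ℚ ℚ.- x)) ℚ.+ x ^ n    ≤⟨ bernoulli n 0≤x (ℚ.<⇒≤ x<1) ⟩
    1ℚ                                          ∎)
  where open ℚ.≤-Reasoning

reciprocal : 0ℚ ℚ.< x → ∃[ y ] 0ℚ ℚ.< y × y ℚ.* x ≡ 1ℚ
reciprocal {x} 0<x = 1/x , ℚ.positive⁻¹ 1/x {{ℚ.1/pos⇒pos x}} , ℚ.*-inverseˡ x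
  where
  instance
    x-pos : ℚ.Positive x
    x-pos = ℚ.positive 0<x
    x≢0 : ℚ.NonZero x
    x≢0 = ℚ.pos⇒nonZero x
  1/x = ℚ.1/ x

-- The witness is y / (c + y).
scale-below : 0ℚ ℚ.≤ c → 0ℚ ℚ.< y → ∃[ d ] 0ℚ ℚ.< d × d ℚ.≤ 1ℚ × c ℚ.* d ℚ.< y
scale-below {c} {y} 0≤c 0<y
  with z , 0<z , z[c+y]≡1 ← reciprocal (ℚ.+-mono-≤-< 0≤c 0<y) =
  y ℚ.* z , 0<p*q 0<y 0<z ,
  p≤p+q (0≤p*q 0≤c (ℚ.<⇒≤ 0<z))
    (trans (solve 3 (λ c y z → y :* z :+ c :* z := z :* (c :+ y)) refl c y z) z[c+y]≡1) ,
  p<p+q (0<p*q 0<y (0<p*q 0<y 0<z))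
    (trans (solve 3 (λ c y z → c :* (y :* z) :+ y :* (y :* z) := y :* (z :* (c :+ y))) refl c y z)
      (trans (cong (y ℚ.*_) z[c+y]≡1) (ℚ.*-identityʳ y)))

-- The recursion builds `C = n Kⁿ⁻¹`, the derivative at `K`, from
-- `y yⁿ - x xⁿ = y (yⁿ - xⁿ) + (y - x) xⁿ`.
^-lipschitz : ∀ K n → 0ℚ ℚ.≤ K → Σ[ C ∈ ℚ ] 0ℚ ℚ.≤ C ×
  (∀ {x y} → 0ℚ ℚ.≤ x → x ℚ.≤ y → y ℚ.≤ K → y ^ n ℚ.≤ x ^ n ℚ.+ C ℚ.* (y ℚ.- x))
^-lipschitz K zero    0≤K = 0ℚ , ℚ.≤-refl , λ {x} {y} _ _ _ → ℚ.≤-reflexive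
  (solve 2 (λ x y → con 1ℚ := con 1ℚ :+ con 0ℚ :* (y :- x)) refl x y)
^-lipschitz K (suc n) 0≤K with C , 0≤C , lip ← ^-lipschitz K n 0≤K =
  K ℚ.* C ℚ.+ K ^ n , 0≤p+q (0≤p*q 0≤K 0≤C) (0≤^ n 0≤K) ,
  λ {x} {y} 0≤x x≤y y≤K → p≤p+q
    (0≤p+q (0≤p+q (0≤p*q (ℚ.≤-trans 0≤x x≤y) (0≤q-p (lip 0≤x x≤y y≤K)))
       (0≤p*q (0≤p*q (0≤q-p y≤K) 0≤C) (0≤q-p x≤y)))
       (0≤p*q (0≤q-p (^-mono-≤ n 0≤x (ℚ.≤-trans x≤y y≤K))) (0≤q-p x≤y)))
    (solve 7 (λ x y K C X Y Z → y :* Y :+ (y :* (X :+ C :* (y :- x) :- Y) :+ (K :- y) :* C :* (y :- x) :+ (Z :- X) :* (y :- x))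
        := x :* X :+ (K :* C :+ Z) :* (y :- x)) refl x y K C (x ^ n) (y ^ n) (K ^ n))

-- Order on extended reals

≤-<-trans : {α : ℝ̄ ℓ} {β : ℝ̄ ℓ′} {γ : ℝ̄ ℓ″} → α ≤ β → β < γ → α < γ
≤-<-trans α≤β (q , q⋪β , q⋖γ) = q , (λ q⋖α → q⋪β (α≤β q q⋖α)) , q⋖γ

⋖-mono : {α : ℝ̄ ℓ} → x ℚ.≤ y → y ⋖ α → x ⋖ α
⋖-mono {x = x} {y = y} {α = α} x≤y y⋖α with ℚ.<-cmp x y
... | tri< x<y _ _ = ℝ̄.down α x<y y⋖α
... | tri≈ _ refl _ = y⋖α
... | tri> _ _ y<x = contradiction (ℚ.<-≤-trans y<x x≤y) (ℚ.<-irrefl refl)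

⋖-fromℚ⁺ : x ℚ.< y → x ⋖ fromℚ y
⋖-fromℚ⁺ x<y = _ , x<y , refl

⋖-fromℚ⁻ : x ⋖ fromℚ y → x ℚ.< y
⋖-fromℚ⁻ (_ , x<y , refl) = x<y

fromℚ-< : {α : ℝ̄ ℓ} → x ⋖ α → fromℚ x < α
fromℚ-< {x = x} x⋖α = x , (λ x⋖x → ℚ.<-irrefl refl (⋖-fromℚ⁻ x⋖x)) , x⋖α

<-fromℚ : {α : ℝ̄ ℓ} → ¬ (x ⋖ α) → x ℚ.< y → α < fromℚ y
<-fromℚ {x = x} x⋪α x<y = x , x⋪α , ⋖-fromℚ⁺ x<y

log₃-mono : {α : ℝ̄ ℓ} {β : ℝ̄ ℓ′} → α ≤ β → log₃ α ≤ log₃ β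
log₃-mono α≤β q (t , q<t , b , 0<b , b≤α , 3ᵗ≤b) = t , q<t , b , 0<b , (λ q q⋖b → α≤β q (b≤α q q⋖b)) , 3ᵗ≤b

-- The root of λ^(m+1) - λ^m - 1 as a cut

midpoint : x ℚ.≤ y → ∃[ z ] x ℚ.≤ z × z ℚ.≤ y × y ℚ.- z ≡ ℚ.½ ℚ.* (y ℚ.- x) × z ℚ.- x ≡ ℚ.½ ℚ.* (y ℚ.- x)
midpoint {x} {y} x≤y = (x ℚ.+ y) ℚ.* ℚ.½ ,
  p≤p+q 0≤δ (solve 2 (λ x y → x :+ con ℚ.½ :* (y :- x) := (x :+ y) :* con ℚ.½) refl x y) ,
  p≤p+q 0≤δ (solve 2 (λ x y → (x :+ y) :* con ℚ.½ :+ con ℚ.½ :* (y :- x) := y) refl x y) ,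
  solve 2 (λ x y → y :- (x :+ y) :* con ℚ.½ := con ℚ.½ :* (y :- x)) refl x y ,
  solve 2 (λ x y → (x :+ y) :* con ℚ.½ :- x := con ℚ.½ :* (y :- x)) refl x y
  where 0≤δ = 0≤p*q (ℚ.nonNegative⁻¹ ℚ.½) (0≤q-p x≤y)

-- This is `p^(m+1) - p^m`, factored so that both factors are visibly nonnegative and nondecreasing
-- on [1, ∞).
excess : ℕ → ℚ → ℚ
excess m p = p ^ m ℚ.* (p ℚ.- 1ℚ)

-- On [1, ∞) the condition excess m p ≤ 1 says that p is at most the positive root of
-- λ^(m+1) - λ^m - 1.
root : ℕ → ℝ̄ 0ℓ
root m = sup (λ p → excess m p ℚ.≤ 1ℚ)

module _ (m : ℕ) where

  private
    f = excess m

  excess-mono-≤ : 1ℚ ℚ.≤ x → x ℚ.≤ y → f x ℚ.≤ f y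
  excess-mono-≤ 1≤x x≤y = *-mono-≤ (0≤^ m 0≤x) (^-mono-≤ m 0≤x x≤y) (0≤q-p 1≤x) (ℚ.+-monoˡ-≤ (ℚ.- 1ℚ) x≤y)
    where 0≤x = ℚ.≤-trans 0≤1 1≤x

  excess-mono-< : 1ℚ ℚ.≤ x → x ℚ.< y → f x ℚ.< f y
  excess-mono-< {x} {y} 1≤x x<y = ℚ.<-≤-trans
    (ℚ.*-monoʳ-<-pos (x ^ m) {{ℚ.positive (0<^ m (ℚ.<-≤-trans 0<1 1≤x))}} (ℚ.+-monoˡ-< (ℚ.- 1ℚ) x<y))
    (*-mono-≤ (0≤^ m 0≤x) (^-mono-≤ m 0≤x (ℚ.<⇒≤ x<y)) (0≤q-p (ℚ.≤-trans 1≤x (ℚ.<⇒≤ x<y))) ℚ.≤-refl)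
    where 0≤x = ℚ.≤-trans 0≤1 1≤x

  excess-1 : f 1ℚ ≡ 0ℚ
  excess-1 = ℚ.*-zeroʳ (1ℚ ^ m)

  ≤root : f x ℚ.≤ 1ℚ → fromℚ x ≤ root m
  ≤root fx≤1 q q⋖x = _ , ⋖-fromℚ⁻ q⋖x , fx≤1

  ⋪root : 1ℚ ℚ.≤ x → 1ℚ ℚ.≤ f x → ¬ (x ⋖ root m)
  ⋪root 1≤x 1≤fx (p , x<p , fp≤1) = ℚ.<-irrefl refl (ℚ.≤-<-trans 1≤fx (ℚ.<-≤-trans (excess-mono-< 1≤x x<p) fp≤1))

  -- The hypothesis only concerns numbers strictly below `y`, so the bound at `y` itself needs
  -- continuity: if `excess` exceeded 1 at `y`, it would exceed 1 slightly to the left as well.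
  ≤root⁻ : 1ℚ ℚ.≤ y → fromℚ y ≤ root m → f y ℚ.≤ 1ℚ
  ≤root⁻ {y} 1≤y y≤root with y ℚ.≤? 1ℚ
  ... | yes y≤1 = ℚ.≤-trans (excess-mono-≤ 1≤y y≤1) (subst (ℚ._≤ 1ℚ) (sym excess-1) 0≤1)
  ... | no  y≰1 = ℚ.≮⇒≥ λ 1<fy →
    let h = y ℚ.- 1ℚ
        0<h = 0<q-p (ℚ.≰⇒> y≰1)
        0≤y = ℚ.≤-trans 0≤1 1≤y
        C , 0≤C , lip = ^-lipschitz y (suc m) 0≤y
        -- The step to the left is a fraction `d ≤ 1` of `y - 1`, which keeps `x` in [1, ∞), where
        -- `excess` is monotone.
        d , 0<d , d≤1 , Chd<e = scale-below (0≤p*q 0≤C (ℚ.<⇒≤ 0<h)) (0<q-p 1<fy)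
        x = y ℚ.- h ℚ.* d
        x<y = p-q<p y (0<p*q 0<h 0<d)
        1≤x = p≤p+q {d = h ℚ.* (1ℚ ℚ.- d)} (0≤p*q (ℚ.<⇒≤ 0<h) (0≤q-p d≤1))
          (solve 2 (λ y d → con 1ℚ :+ (y :- con 1ℚ) :* (con 1ℚ :- d) := y :- (y :- con 1ℚ) :* d) refl y d)
        0≤x = ℚ.≤-trans 0≤1 1≤x
        p , x<p , fp≤1 = y≤root x (⋖-fromℚ⁺ x<y)
        fx≤1 = ℚ.≤-trans (excess-mono-≤ 1≤x (ℚ.<⇒≤ x<p)) fp≤1
    in ℚ.<-irrefl refl (begin-strict
      f y                                                 ≡⟨ solve 2 (λ y Y → Y :* (y :- con 1ℚ) := y :* Y :- Y) refl y (y ^ m) ⟩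
      y ^ suc m ℚ.- y ^ m                                 ≤⟨ ℚ.+-mono-≤ (lip 0≤x (ℚ.<⇒≤ x<y) ℚ.≤-refl)
                                                               (ℚ.neg-antimono-≤ (^-mono-≤ m 0≤x (ℚ.<⇒≤ x<y))) ⟩
      x ^ suc m ℚ.+ C ℚ.* (y ℚ.- x) ℚ.- x ^ m             ≡⟨ solve 5 (λ x X C y e → x :* X :+ C :* (y :- (y :- e)) :- X := X :* (x :- con 1ℚ) :+ C :* e)
                                                               refl x (x ^ m) C y (h ℚ.* d) ⟩
      f x ℚ.+ C ℚ.* (h ℚ.* d)                             ≡⟨ cong (f x ℚ.+_) (ℚ.*-assoc C h d) ⟨
      f x ℚ.+ C ℚ.* h ℚ.* d                               <⟨ ℚ.+-mono-≤-< fx≤1 Chd<e ⟩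
      1ℚ ℚ.+ (f y ℚ.- 1ℚ)                                 ≡⟨ solve 1 (λ F → con 1ℚ :+ (F :- con 1ℚ) := F) refl (f y) ⟩
      f y                                                 ∎)
    where open ℚ.≤-Reasoning

  Bracket : ℕ → ℚ → ℚ → Set
  Bracket k x y = 1ℚ ℚ.≤ x × x ℚ.≤ y × y ℚ.≤ ι 2 × f x ℚ.≤ 1ℚ × 1ℚ ℚ.≤ f y × y ℚ.- x ≡ ℚ.½ ^ k

  -- Bisection starting from [1, 2], where `excess` takes the values 0 and `2^m`. It supplies
  -- rationals on both sides of the root at any prescribed distance.
  bracket : ∀ k → ∃[ x ] ∃[ y ] Bracket k x y
  bracket zero = 1ℚ , ι 2 , ℚ.≤-refl , 1≤2 , ℚ.≤-refl , subst (ℚ._≤ 1ℚ) (sym excess-1) 0≤1 ,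
    subst (1ℚ ℚ.≤_) (sym (ℚ.*-identityʳ (ι 2 ^ m))) (1≤^ m 1≤2) , refl
    where
    1≤2 : 1ℚ ℚ.≤ ι 2
    1≤2 = ι-mono-≤ {1} {2} (ℕ.s≤s ℕ.z≤n)
  bracket (suc k) = bisect (bracket k)
    where
    half-gap : ∀ {d} → d ≡ ℚ.½ ^ k → ℚ.½ ℚ.* d ≡ ℚ.½ ^ suc k
    half-gap refl = refl
    choose : ∀ {x y} → Bracket k x y →
      ∃[ z ] x ℚ.≤ z × z ℚ.≤ y × y ℚ.- z ≡ ℚ.½ ℚ.* (y ℚ.- x) × z ℚ.- x ≡ ℚ.½ ℚ.* (y ℚ.- x) →
      ∃[ x ] ∃[ y ] Bracket (suc k) x y
    choose {x} {y} (1≤x , x≤y , y≤2 , fx≤1 , 1≤fy , gap) (z , x≤z , z≤y , y-z , z-x) =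
      [ (λ fz≤1 → z , y , ℚ.≤-trans 1≤x x≤z , z≤y , y≤2 , fz≤1 , 1≤fy , trans y-z (half-gap gap))
      , (λ 1≤fz → x , z , 1≤x , x≤z , ℚ.≤-trans z≤y y≤2 , fx≤1 , 1≤fz , trans z-x (half-gap gap))
      ]′ (ℚ.≤-total (f z) 1ℚ)
    bisect : ∃[ x ] ∃[ y ] Bracket k x y → ∃[ x ] ∃[ y ] Bracket (suc k) x y
    bisect (x , y , br@(_ , x≤y , _)) = choose br (midpoint x≤y)

  -- For the upper bound one point suffices: a rational below the negated power is at most `- b^m`
  -- for every `b ≤ root`, in particular for the `b` that bounds the first power, and `f b ≤ 1`. The
  -- lower bound needs two points: the first power is approached from some `x` below the root, the
  -- negated one from some `y` above it.
  root-equation : root m ^ⁿ suc m - root m ^ⁿ m - fromℚ 1ℚ ≈ fromℚ 0ℚ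
  root-equation = nonPositive , nonNegative
    where
    nonPositive : root m ^ⁿ suc m - root m ^ⁿ m - fromℚ 1ℚ ≤ fromℚ 0ℚ
    nonPositive q (_ , q<u+v , u , v ,
        (_ , u<u₁+v₁ , u₁ , v₁ , (_ , u₁<bⁿ , b , 0≤b , b≤root , refl) , (p₁ , v₁<p₁ , -p₁⋪root) , refl) ,
        (p , v<p , -p⋪1) , refl) = ⋖-fromℚ⁺ (begin-strict
      q                                          <⟨ q<u+v ⟩
      u ℚ.+ v                                    <⟨ ℚ.+-mono-< (ℚ.<-trans u<u₁+v₁ (ℚ.+-mono-< u₁<bⁿ v₁<p₁)) v<p ⟩
      b ^ suc m ℚ.+ p₁ ℚ.+ p                     ≤⟨ ℚ.+-mono-≤ (ℚ.+-monoʳ-≤ (b ^ suc m) p₁≤) p≤-1 ⟩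
      b ^ suc m ℚ.- b ^ m ℚ.- 1ℚ                 ≡⟨ solve 2 (λ b B → b :* B :- B :- con 1ℚ := B :* (b :- con 1ℚ) :- con 1ℚ) refl b (b ^ m) ⟩
      f b ℚ.- 1ℚ                                 ≤⟨ ℚ.+-monoˡ-≤ (ℚ.- 1ℚ) fb≤1 ⟩
      0ℚ                                         ∎)
      where
      open ℚ.≤-Reasoning
      neg-≤ : ∀ {p q} → q ℚ.≤ ℚ.- p → p ℚ.≤ ℚ.- q
      neg-≤ {p} q≤-p = subst (ℚ._≤ _) (solve 1 (λ p → :- (:- p) := p) refl p) (ℚ.neg-antimono-≤ q≤-p)
      p≤-1 : p ℚ.≤ ℚ.- 1ℚ
      p≤-1 = neg-≤ (ℚ.≮⇒≥ λ -p<1 → -p⋪1 (⋖-fromℚ⁺ -p<1))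
      p₁≤ : p₁ ℚ.≤ ℚ.- (b ^ m)
      p₁≤ = neg-≤ (ℚ.≮⇒≥ λ -p₁<bᵐ → -p₁⋪root (_ , -p₁<bᵐ , b , 0≤b , b≤root , refl))
      fb≤1 : f b ℚ.≤ 1ℚ
      fb≤1 with ℚ.≤-total 1ℚ b
      ... | inj₁ 1≤b = ≤root⁻ 1≤b b≤root
      ... | inj₂ b≤1 = ℚ.≤-trans (p≤p+q {y = 0ℚ} (0≤p*q (0≤^ m 0≤b) (0≤q-p b≤1))
        (solve 2 (λ b B → B :* (b :- con 1ℚ) :+ B :* (con 1ℚ :- b) := con 0ℚ) refl b (b ^ m))) 0≤1

    -yᵐ⋪ : 1ℚ ℚ.≤ y → 1ℚ ℚ.≤ f y → ¬ (ℚ.- (ℚ.- (y ^ m)) ⋖ root m ^ⁿ m)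
    -yᵐ⋪ {y} 1≤y 1≤fy (_ , yᵐ<bᵐ , b , 0≤b , b≤root , refl) = ⋪root 1≤y 1≤fy (b≤root y (⋖-fromℚ⁺ y<b))
      where
      yᵐ<bᵐ′ : y ^ m ℚ.< b ^ m
      yᵐ<bᵐ′ = subst (ℚ._< b ^ m) (solve 1 (λ p → :- (:- p) := p) refl (y ^ m)) yᵐ<bᵐ
      y<b : y ℚ.< b
      y<b = ℚ.≰⇒> λ b≤y → ℚ.<-irrefl refl (ℚ.<-≤-trans yᵐ<bᵐ′ (^-mono-≤ m 0≤b b≤y))

    -- Of the eight shares `e` in `q`, four pay for strict inequalities in the cuts and one for `D`,
    -- the loss from replacing `y^(m+1)` by `x^(m+1)`; the other three make the final inequality
    -- strict.
    close : ∀ {x y q e D} → 0ℚ ℚ.< e → 1ℚ ℚ.≤ x → x ℚ.≤ y → f x ℚ.≤ 1ℚ → 1ℚ ℚ.≤ f y →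
      y ^ suc m ℚ.≤ x ^ suc m ℚ.+ D → D ℚ.≤ e → q ≡ ℚ.- (e ℚ.* ι 8) →
      q ⋖ root m ^ⁿ suc m - root m ^ⁿ m - fromℚ 1ℚ
    close {x} {y} {e = e} {D} 0<e 1≤x x≤y fx≤1 1≤fy y≤x+D D≤e refl =
      _ , p<p+q (ℚ.+-mono-<-≤ (0<p*q 0<e (ℚ.positive⁻¹ (ι 3)))
            (0≤p+q (0≤p+q (0≤q-p y≤x+D) (0≤q-p D≤e)) (0≤q-p 1≤fy)))
          (solve 5 (λ e X y Y D →
              :- (e :* con (ι 8)) :+ (e :* con (ι 3) :+ ((X :+ D :- y :* Y) :+ (e :- D) :+ (Y :* (y :- con 1ℚ) :- con 1ℚ)))
                := ((X :- e) :+ (:- Y :- e) :- e) :+ (:- con 1ℚ :- e))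
            refl e (x ^ suc m) y (y ^ m) D) ,
        _ , _ ,
        (_ , p-q<p _ 0<e , _ , _ ,
          (_ , p-q<p _ 0<e , x , ℚ.≤-trans 0≤1 1≤x , ≤root fx≤1 , refl) ,
          (_ , p-q<p _ 0<e , -yᵐ⋪ (ℚ.≤-trans 1≤x x≤y) 1≤fy) , refl) ,
        (ℚ.- 1ℚ , p-q<p (ℚ.- 1ℚ) 0<e , λ 1⋖1 → ℚ.<-irrefl refl (⋖-fromℚ⁻ 1⋖1)) , refl

    nonNegative : fromℚ 0ℚ ≤ root m ^ⁿ suc m - root m ^ⁿ m - fromℚ 1ℚ
    nonNegative q q⋖0 =
      let C , 0≤C , lip = ^-lipschitz (ι 2) (suc m) (0≤ι 2)
          0<e = 0<p*q (ℚ.neg-antimono-< (⋖-fromℚ⁻ q⋖0)) (ℚ.positive⁻¹ (+ 1 / 8))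
          d , 0<d , _ , Cd<e = scale-below 0≤C 0<e
          k , ½ᵏ<d = ^-limit (ℚ.nonNegative⁻¹ ℚ.½) (ℚ.*<* (ℤ.+<+ (ℕ.s≤s (ℕ.s≤s ℕ.z≤n)))) 0<d
          x , y , 1≤x , x≤y , y≤2 , fx≤1 , 1≤fy , gap = bracket k
      in close 0<e 1≤x x≤y fx≤1 1≤fy (lip (ℚ.≤-trans 0≤1 1≤x) x≤y y≤2)
           (ℚ.≤-trans (ℚ.*-monoˡ-≤-nonNeg C {{ℚ.nonNegative 0≤C}}
              (ℚ.≤-trans (ℚ.≤-reflexive gap) (ℚ.<⇒≤ ½ᵏ<d))) (ℚ.<⇒≤ Cd<e))
           (solve 1 (λ q → q := :- (:- q :* con (+ 1 / 8) :* con (ι 8))) refl q)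

-- The golden ratio as `root 1`

-- Completing the square: `(2p - 1)² = 4p(p - 1) + 1`, so `(2p - 1)² ≤ 5` amounts to
-- `excess 1 p ≤ 1`. Squaring needs `2p - 1 ≥ 0`, hence the separate case `p ≤ 1`.
golden≤root : goldenRatio ≤ root 1
golden≤root q (p , q<p , _ , 2p<u+v , u , v , u⋖1 , (w , v<w , w²≤5) , refl) = small-or-large (ℚ.≤-total p 1ℚ)
  where
  open ℚ.≤-Reasoning
  2p-1<w : p ℚ.+ p ℚ.- 1ℚ ℚ.< w
  2p-1<w = begin-strict
    p ℚ.+ p ℚ.- 1ℚ     <⟨ ℚ.+-monoˡ-< (ℚ.- 1ℚ) (ℚ.<-trans 2p<u+v (ℚ.+-mono-< (⋖-fromℚ⁻ u⋖1) v<w)) ⟩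
    1ℚ ℚ.+ w ℚ.- 1ℚ    ≡⟨ solve 1 (λ w → con 1ℚ :+ w :- con 1ℚ := w) refl w ⟩
    w                  ∎
  small-or-large : p ℚ.≤ 1ℚ ⊎ 1ℚ ℚ.≤ p → q ⋖ root 1
  small-or-large (inj₁ p≤1) = 1ℚ , ℚ.<-≤-trans q<p p≤1 , 0≤1
  small-or-large (inj₂ 1≤p) = p , q<p , ℚ.*-cancelˡ-≤-pos (ι 4) (p≤p+q (0≤p+q (0≤q-p (^-mono-≤ 2 0≤2p-1 (ℚ.<⇒≤ 2p-1<w))) (0≤q-p w²≤5))
      (solve 2 (λ p w → let r = p :+ p :- con 1ℚ in
          con (ι 4) :* (p :* con 1ℚ :* (p :- con 1ℚ)) :+ ((w :* (w :* con 1ℚ) :- r :* (r :* con 1ℚ)) :+ (con (+ 5 / 1) :- w :* w))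
            := con (ι 4) :* con 1ℚ) refl p w))
    where
    0≤2p-1 : 0ℚ ℚ.≤ p ℚ.+ p ℚ.- 1ℚ
    0≤2p-1 = ℚ.≤-trans (ℚ.≤-trans 0≤1 1≤p) (p≤p+q (0≤q-p 1≤p)
      (solve 1 (λ p → p :+ (p :- con 1ℚ) := p :+ p :- con 1ℚ) refl p))

root≤golden : root 1 ≤ goldenRatio
root≤golden q (p , q<p , fp≤1) =
  let e = p ℚ.- q
      0<e = 0<q-p q<p
      h = e ℚ.* ℚ.½
      0<h = 0<p*q 0<e (ℚ.positive⁻¹ ℚ.½)
  in p ℚ.- h ,
     p<p+q 0<h (solve 2 (λ p q → let h = (p :- q) :* con ℚ.½ in q :+ h := p :- h) refl p q) ,
     _ ,
     p<p+q {d = h} {y = 1ℚ ℚ.- h ℚ.* ℚ.½ ℚ.+ (p ℚ.+ p ℚ.- 1ℚ ℚ.- h ℚ.* ℚ.½)} 0<h (solve 2 (λ p h → ((p :- h) :+ (p :- h)) :+ h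
        := (con 1ℚ :- h :* con ℚ.½) :+ (p :+ p :- con 1ℚ :- h :* con ℚ.½)) refl p h) ,
     1ℚ ℚ.- h ℚ.* ℚ.½ , p ℚ.+ p ℚ.- 1ℚ ℚ.- h ℚ.* ℚ.½ ,
     ⋖-fromℚ⁺ (p-q<p 1ℚ (0<p*q 0<h (ℚ.positive⁻¹ ℚ.½))) ,
     (p ℚ.+ p ℚ.- 1ℚ , p-q<p (p ℚ.+ p ℚ.- 1ℚ) (0<p*q 0<h (ℚ.positive⁻¹ ℚ.½)) ,
       p≤p+q (0≤p*q (0≤ι 4) (0≤q-p fp≤1))
         (solve 1 (λ p → let r = p :+ p :- con 1ℚ in
            r :* r :+ con (ι 4) :* (con 1ℚ :- p :* con 1ℚ :* (p :- con 1ℚ)) := con (+ 5 / 1)) refl p)) ,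
     refl

-- Numerical values of roots and logarithms

^-ratio : ∀ n → 0ℚ ℚ.≤ x → x ^ n ℚ.* ι (↧ₙ x ℕ.^ n) ≡ ι (∣ ↥ x ∣ ℕ.^ n)
^-ratio {x} n 0≤x = begin
  x ^ n ℚ.* ι (↧ₙ x ℕ.^ n)   ≡⟨ cong (x ^ n ℚ.*_) (ι-^ (↧ₙ x) n) ⟩
  x ^ n ℚ.* ι (↧ₙ x) ^ n     ≡⟨ ^-distrib-* x (ι (↧ₙ x)) n ⟨
  (x ℚ.* ι (↧ₙ x)) ^ n       ≡⟨ cong (_^ n) (q*↧q≡∣↥q∣ 0≤x) ⟩
  ι ∣ ↥ x ∣ ^ n              ≡⟨ ι-^ ∣ ↥ x ∣ n ⟨
  ι (∣ ↥ x ∣ ℕ.^ n)          ∎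
  where open ≡-Reasoning

0<ι^ : ∀ d-1 n → ℚ.Positive (ι (suc d-1 ℕ.^ n))
0<ι^ d-1 n = ℚ.positive (ι-mono-< (ℕ.m^n>0 (suc d-1) n))

-- Clearing denominators leaves a comparison of natural numbers, which evaluation settles even for
-- powers with thousands of digits; rational powers would normalise by a gcd at each multiplication.
ι≤^ : ∀ c n → 0ℚ ℚ.≤ x → c ℕ.* ↧ₙ x ℕ.^ n ℕ.≤ ∣ ↥ x ∣ ℕ.^ n → ι c ℚ.≤ x ^ n
ι≤^ {x} c n 0≤x cDⁿ≤Nⁿ = ℚ.*-cancelʳ-≤-pos (ι (↧ₙ x ℕ.^ n)) {{0<ι^ (ℚ.denominator-1 x) n}} (begin
  ι c ℚ.* ι (↧ₙ x ℕ.^ n)      ≡⟨ ι-* c (↧ₙ x ℕ.^ n) ⟨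
  ι (c ℕ.* ↧ₙ x ℕ.^ n)        ≤⟨ ι-mono-≤ cDⁿ≤Nⁿ ⟩
  ι (∣ ↥ x ∣ ℕ.^ n)           ≡⟨ ^-ratio {x} n 0≤x ⟨
  x ^ n ℚ.* ι (↧ₙ x ℕ.^ n)    ∎)
  where open ℚ.≤-Reasoning

^≤ι : ∀ c n → 0ℚ ℚ.≤ x → ∣ ↥ x ∣ ℕ.^ n ℕ.≤ c ℕ.* ↧ₙ x ℕ.^ n → x ^ n ℚ.≤ ι c
^≤ι {x} c n 0≤x Nⁿ≤cDⁿ = ℚ.*-cancelʳ-≤-pos (ι (↧ₙ x ℕ.^ n)) {{0<ι^ (ℚ.denominator-1 x) n}} (begin
  x ^ n ℚ.* ι (↧ₙ x ℕ.^ n)    ≡⟨ ^-ratio {x} n 0≤x ⟩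
  ι (∣ ↥ x ∣ ℕ.^ n)           ≤⟨ ι-mono-≤ Nⁿ≤cDⁿ ⟩
  ι (c ℕ.* ↧ₙ x ℕ.^ n)        ≡⟨ ι-* c (↧ₙ x ℕ.^ n) ⟩
  ι c ℚ.* ι (↧ₙ x ℕ.^ n)      ∎)
  where open ℚ.≤-Reasoning

3^∣↥t∣ : 0ℚ ℚ.< x → 3^ (↥ x) ≡ ι (3 ℕ.^ ∣ ↥ x ∣)
3^∣↥t∣ {ℚ.mkℚ (+ n) _ _}    0<t = sym (ι-^ 3 n)
3^∣↥t∣ {ℚ.mkℚ -[1+ _ ] _ _} (ℚ.*<* ())

cross-< : 0ℚ ℚ.< x → x ℚ.< y → ∣ ↥ x ∣ ℕ.* ↧ₙ y ℕ.< ∣ ↥ y ∣ ℕ.* ↧ₙ x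
cross-< {ℚ.mkℚ (+ m) c _} {ℚ.mkℚ (+ n) d _} _ (ℚ.*<* lt) =
  ℤ.drop‿+<+ (subst₂ ℤ._<_ (sym (ℤ.pos-* m (suc d))) (sym (ℤ.pos-* n (suc c))) lt)
cross-< {ℚ.mkℚ (+ _) _ _} {ℚ.mkℚ -[1+ _ ] _ _} 0<x x<y = contradiction (ℚ.<-trans 0<x x<y) λ { (ℚ.*<* ()) }
cross-< {ℚ.mkℚ -[1+ _ ] _ _} (ℚ.*<* ())

log₃-lower : {α : ℝ̄ ℓ} → ∀ t b → 0ℚ ℚ.< t → 0ℚ ℚ.< b → fromℚ b ≤ α → x ℚ.< t →
  3 ℕ.^ ∣ ↥ t ∣ ℕ.* ↧ₙ b ℕ.^ ↧ₙ t ℕ.≤ ∣ ↥ b ∣ ℕ.^ ↧ₙ t → fromℚ x < log₃ α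
log₃-lower {α = α} t b 0<t 0<b b≤α x<t 3ᵗ≤b = fromℚ-< {α = log₃ α} (t , x<t , b , 0<b , b≤α ,
  subst (ℚ._≤ b ^ ↧ₙ t) (sym (3^∣↥t∣ 0<t)) (ι≤^ (3 ℕ.^ ∣ ↥ t ∣) (↧ₙ t) (ℚ.<⇒≤ 0<b) 3ᵗ≤b))

-- An `s > t` in the set defining the logarithm comes with some `a ≤ b`, since `b` is not below the
-- root. Then `3^s ≤ a ≤ b ≤ 3^t`, which is refuted after raising to the product of the
-- denominators.
log₃-upper : ∀ m t b → 0ℚ ℚ.< t → 1ℚ ℚ.≤ b → 1ℚ ℚ.≤ excess m b → t ℚ.< x →
  ∣ ↥ b ∣ ℕ.^ ↧ₙ t ℕ.≤ 3 ℕ.^ ∣ ↥ t ∣ ℕ.* ↧ₙ b ℕ.^ ↧ₙ t → log₃ (root m) < fromℚ x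
log₃-upper m t b 0<t 1≤b 1≤fb t<x b≤3ᵗ = <-fromℚ {α = log₃ (root m)} t⋪ t<x
  where
  open ℚ.≤-Reasoning
  0≤b = ℚ.≤-trans 0≤1 1≤b
  t⋪ : ¬ (t ⋖ log₃ (root m))
  t⋪ (s , t<s , a , 0<a , a≤root , 3ˢ≤a) = ℚ.<-irrefl refl (begin-strict
    b ^ (↧ₙ t ℕ.* ↧ₙ s)                  ≡⟨ ^-assocʳ b (↧ₙ t) (↧ₙ s) ⟨
    (b ^ ↧ₙ t) ^ ↧ₙ s                    ≤⟨ ^-mono-≤ (↧ₙ s) (0≤^ (↧ₙ t) 0≤b) (^≤ι (3 ℕ.^ ∣ ↥ t ∣) (↧ₙ t) 0≤b b≤3ᵗ) ⟩
    ι (3 ℕ.^ ∣ ↥ t ∣) ^ ↧ₙ s             ≡⟨ ι-^ (3 ℕ.^ ∣ ↥ t ∣) (↧ₙ s) ⟨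
    ι ((3 ℕ.^ ∣ ↥ t ∣) ℕ.^ ↧ₙ s)         ≡⟨ cong ι (ℕ.^-*-assoc 3 ∣ ↥ t ∣ (↧ₙ s)) ⟩
    ι (3 ℕ.^ (∣ ↥ t ∣ ℕ.* ↧ₙ s))         <⟨ ι-mono-< (ℕ.^-monoʳ-< 3 (ℕ.s≤s (ℕ.s≤s ℕ.z≤n)) (cross-< 0<t t<s)) ⟩
    ι (3 ℕ.^ (∣ ↥ s ∣ ℕ.* ↧ₙ t))         ≡⟨ cong ι (ℕ.^-*-assoc 3 ∣ ↥ s ∣ (↧ₙ t)) ⟨
    ι ((3 ℕ.^ ∣ ↥ s ∣) ℕ.^ ↧ₙ t)         ≡⟨ ι-^ (3 ℕ.^ ∣ ↥ s ∣) (↧ₙ t) ⟩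
    ι (3 ℕ.^ ∣ ↥ s ∣) ^ ↧ₙ t             ≤⟨ ^-mono-≤ (↧ₙ t) (0≤ι _) (subst (ℚ._≤ a ^ ↧ₙ s) (3^∣↥t∣ (ℚ.<-trans 0<t t<s)) 3ˢ≤a) ⟩
    (a ^ ↧ₙ s) ^ ↧ₙ t                    ≤⟨ ^-mono-≤ (↧ₙ t) (0≤^ (↧ₙ s) (ℚ.<⇒≤ 0<a)) (^-mono-≤ (↧ₙ s) (ℚ.<⇒≤ 0<a) a≤b) ⟩
    (b ^ ↧ₙ s) ^ ↧ₙ t                    ≡⟨ ^-swap b (↧ₙ s) (↧ₙ t) ⟩
    (b ^ ↧ₙ t) ^ ↧ₙ s                    ≡⟨ ^-assocʳ b (↧ₙ t) (↧ₙ s) ⟩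
    b ^ (↧ₙ t ℕ.* ↧ₙ s)                  ∎)
    where
    a≤b : a ℚ.≤ b
    a≤b = ℚ.≮⇒≥ λ b<a → ⋪root m 1≤b 1≤fb (a≤root b (⋖-fromℚ⁺ b<a))

-- The bases b are continued-fraction convergents of the roots, the exponents t the simplest
-- fractions between the logarithm and the required bound.
golden-log : log₃ goldenRatio ≐ + 438018 / 1000000 ± (+ 1 / 1000000)
golden-log =
  log₃-lower {α = goldenRatio} (+ 2696 / 6155) (+ 17711 / 10946) (toWitness {a? = 0ℚ ℚ.<? _} tt) (toWitness {a? = 0ℚ ℚ.<? _} tt)
    (λ q q⋖b → root≤golden q (≤root 1 (ℚ.≤ᵇ⇒≤ tt) q q⋖b)) (toWitness {a? = _ ℚ.<? _} tt) (ℕ.≤ᵇ⇒≤ _ _ tt) ,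
  ≤-<-trans {α = log₃ goldenRatio} {log₃ (root 1)} {fromℚ (+ 438018 / 1000000 ℚ.+ + 1 / 1000000)}
    (log₃-mono {α = goldenRatio} {root 1} golden≤root)
    (log₃-upper 1 (+ 1477 / 3372) (+ 1597 / 987) (toWitness {a? = 0ℚ ℚ.<? _} tt) (ℚ.≤ᵇ⇒≤ tt) (ℚ.≤ᵇ⇒≤ tt)
      (toWitness {a? = _ ℚ.<? _} tt) (ℕ.≤ᵇ⇒≤ _ _ tt))

root-5 : root 5 ≐ + 128520 / 100000 ± (+ 1 / 100000)
root-5 =
  fromℚ-< {α = root 5} (+ 29219 / 22735 , toWitness {a? = _ ℚ.<? _} tt , ℚ.≤ᵇ⇒≤ tt) ,
  <-fromℚ {α = root 5} (⋪root 5 {+ 9621 / 7486} (ℚ.≤ᵇ⇒≤ tt) (ℚ.≤ᵇ⇒≤ tt)) (toWitness {a? = _ ℚ.<? _} tt)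

root-5-log : log₃ (root 5) ≐ + 228392 / 1000000 ± (+ 1 / 1000000)
root-5-log =
  log₃-lower {α = root 5} (+ 362 / 1585) (+ 29219 / 22735) (toWitness {a? = 0ℚ ℚ.<? _} tt) (toWitness {a? = 0ℚ ℚ.<? _} tt)
    (≤root 5 (ℚ.≤ᵇ⇒≤ tt)) (toWitness {a? = _ ℚ.<? _} tt) (ℕ.≤ᵇ⇒≤ _ _ tt) ,
  log₃-upper 5 (+ 399 / 1747) (+ 9621 / 7486) (toWitness {a? = 0ℚ ℚ.<? _} tt) (ℚ.≤ᵇ⇒≤ tt) (ℚ.≤ᵇ⇒≤ tt)
      (toWitness {a? = _ ℚ.<? _} tt) (ℕ.≤ᵇ⇒≤ _ _ tt)

-- Sparse expansions and their multiples

-- The edges of an automaton whose state counts the zeros still forced; for `m = 1` it presents the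
-- golden mean shift.
data Step (m : ℕ) : ℕ → Fin 3 → ℕ → Set where
  rest  : Step m 0 0F 0
  start : Step m 0 1F m
  wait  : ∀ {r} → Step m (suc r) 0F r

-- Any two digits 1 of x are more than m places apart, the other digits being 0; r n counts
-- the places from n onwards in which a 1 is still forbidden.
Sparse : ℕ → Pred ℤ₃ 0ℓ
Sparse m x = Σ[ r ∈ (ℕ → ℕ) ] r 0 ≡ 0 × (∀ n → Step m (r n) (x n) (r (suc n)))

NoTwo : ℕ → Set
NoTwo N = ∀ j → N /3^ j % 3 ≢ 2

module _ {A M k : ℕ} (A<3ᵏ : A ℕ.< 3 ℕ.^ k) where
  private
    P = 3 ℕ.^ k
    instance
      P≢0 : NonZero P
      P≢0 = ℕ.m^n≢0 3 k

  open ≡-Reasoning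

  append-low : ∀ {j} → j ℕ.< k → (A ℕ.+ M ℕ.* P) /3^ j % 3 ≡ A /3^ j % 3
  append-low {j} j<k = begin
    (A ℕ.+ M ℕ.* P) /ℕ J % 3                   ≡⟨ cong (λ N → (A ℕ.+ N) /ℕ J % 3) MP≡ ⟩
    (A ℕ.+ M ℕ.* Q ℕ.* 3 ℕ.* J) /ℕ J % 3       ≡⟨ cong (_% 3) (+-distrib-/-∣ʳ A (n∣m*n (M ℕ.* Q ℕ.* 3))) ⟩
    (A /ℕ J ℕ.+ M ℕ.* Q ℕ.* 3 ℕ.* J /ℕ J) % 3  ≡⟨ cong (λ N → (A /ℕ J ℕ.+ N) % 3) (m*n/n≡m (M ℕ.* Q ℕ.* 3) J) ⟩
    (A /ℕ J ℕ.+ M ℕ.* Q ℕ.* 3) % 3             ≡⟨ [m+kn]%n≡m%n (A /ℕ J) (M ℕ.* Q) 3 ⟩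
    A /ℕ J % 3                                 ∎
    where
    J = 3 ℕ.^ j
    instance
      J≢0 : NonZero J
      J≢0 = ℕ.m^n≢0 3 j
    Q = 3 ℕ.^ (k ℕ.∸ suc j)
    MP≡ : M ℕ.* P ≡ M ℕ.* Q ℕ.* 3 ℕ.* J
    MP≡ = begin
      M ℕ.* P                              ≡⟨ cong (λ n → M ℕ.* 3 ℕ.^ n) (ℕ.m∸n+n≡m j<k) ⟨
      M ℕ.* 3 ℕ.^ (k ℕ.∸ suc j ℕ.+ suc j)  ≡⟨ cong (M ℕ.*_) (ℕ.^-distribˡ-+-* 3 (k ℕ.∸ suc j) (suc j)) ⟩
      M ℕ.* (Q ℕ.* (3 ℕ.* J))              ≡⟨ ℕ.*-assoc M Q (3 ℕ.* J) ⟨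
      M ℕ.* Q ℕ.* (3 ℕ.* J)                ≡⟨ ℕ.*-assoc (M ℕ.* Q) 3 J ⟨
      M ℕ.* Q ℕ.* 3 ℕ.* J                  ∎

  append-high : ∀ {j} → k ℕ.≤ j → (A ℕ.+ M ℕ.* P) /3^ j ≡ M /3^ (j ℕ.∸ k)
  append-high {j} k≤j = begin
    (A ℕ.+ M ℕ.* P) /ℕ 3 ℕ.^ j      ≡⟨ /-congʳ (trans (cong (3 ℕ.^_) (sym (ℕ.m+[n∸m]≡n k≤j))) (ℕ.^-distribˡ-+-* 3 k (j ℕ.∸ k))) ⟩
    (A ℕ.+ M ℕ.* P) /ℕ (P ℕ.* R)    ≡⟨ m/n/o≡m/[n*o] (A ℕ.+ M ℕ.* P) P R ⟨
    (A ℕ.+ M ℕ.* P) /ℕ P /ℕ R       ≡⟨ cong (_/ℕ R) (+-distrib-/-∣ʳ A (n∣m*n M)) ⟩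
    (A /ℕ P ℕ.+ M ℕ.* P /ℕ P) /ℕ R  ≡⟨ cong₂ (λ a b → (a ℕ.+ b) /ℕ R) (m<n⇒m/n≡0 A<3ᵏ) (m*n/n≡m M P) ⟩
    M /ℕ R                          ∎
    where
    R = 3 ℕ.^ (j ℕ.∸ k)
    instance
      3ʲ≢0 : NonZero (3 ℕ.^ j)
      3ʲ≢0 = ℕ.m^n≢0 3 j
      R≢0 : NonZero R
      R≢0 = ℕ.m^n≢0 3 (j ℕ.∸ k)
      PR≢0 : NonZero (P ℕ.* R)
      PR≢0 = ℕ.m*n≢0 P R

  -- There is no carry: `M * P` leaves the digits below `k` to `A`, and `A < 3^k` leaves the others
  -- to `M`.
  NoTwo-append : NoTwo A → NoTwo M → NoTwo (A ℕ.+ M ℕ.* P)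
  NoTwo-append noTwoA noTwoM j digit≡2 with ℕ.<-≤-connex j k
  ... | inj₁ j<k = noTwoA j (trans (sym (append-low j<k)) digit≡2)
  ... | inj₂ k≤j = noTwoM (j ℕ.∸ k) (trans (cong (_% 3) (sym (append-high k≤j))) digit≡2)

NoTwo-0 : NoTwo 0
NoTwo-0 j eq = contradiction (trans (cong (_% 3) (sym (0/n≡0 (3 ℕ.^ j) {{ℕ.m^n≢0 3 j}}))) eq) λ ()

NoTwo-1 : NoTwo 1
NoTwo-1 zero    ()
NoTwo-1 (suc j) eq = contradiction (trans (cong (_% 3) (sym (m<n⇒m/n≡0 {{ℕ.m^n≢0 3 (suc j)}} 1<3^))) eq) λ ()
  where
  1<3^ : 1 ℕ.< 3 ℕ.^ suc j
  1<3^ = ℕ.^-monoʳ-< 3 (ℕ.s≤s (ℕ.s≤s ℕ.z≤n)) {0} {suc j} (ℕ.s≤s ℕ.z≤n)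

NoTwo-4 : NoTwo 4
NoTwo-4 = NoTwo-append {1} {1} {1} (ℕ.<ᵇ⇒< 1 3 tt) NoTwo-1 NoTwo-1

-- 256 = 1 + 3 + 3² + 3⁵
NoTwo-256 : NoTwo 256
NoTwo-256 = NoTwo-append {13} {1} {5} (ℕ.<ᵇ⇒< 13 243 tt)
  (NoTwo-append {4} {1} {2} (ℕ.<ᵇ⇒< 4 9 tt) NoTwo-4 NoTwo-1) NoTwo-1

module _ {m M : ℕ} (M<3ᵐ⁺¹ : M ℕ.< 3 ℕ.^ suc m) (noTwoM : NoTwo M) where

  -- The bound `M * T < 3^(k + r)` says that the last copy of `M` ends no later than the forced
  -- zeros. A new digit 1 comes only when `r = 0`, so its copy of `M` lies wholly above `M * T`.
  step-product : ∀ {r d r′} T k → Step m r d r′ → M ℕ.* T ℕ.< 3 ℕ.^ (k ℕ.+ r) → NoTwo (M ℕ.* T) →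
    M ℕ.* (T ℕ.+ toℕ d ℕ.* 3 ℕ.^ k) ℕ.< 3 ℕ.^ (suc k ℕ.+ r′) × NoTwo (M ℕ.* (T ℕ.+ toℕ d ℕ.* 3 ℕ.^ k))
  step-product T k rest MT< noTwo rewrite ℕ.+-identityʳ T =
    ℕ.<-≤-trans MT< (ℕ.^-monoʳ-≤ 3 (ℕ.n≤1+n (k ℕ.+ 0))) , noTwo
  step-product {r = suc r} T k wait MT< noTwo rewrite ℕ.+-identityʳ T =
    subst (λ e → M ℕ.* T ℕ.< 3 ℕ.^ e) (ℕ.+-suc k r) MT< , noTwo
  step-product T k start MT< noTwo = subst (ℕ._< 3 ℕ.^ (suc k ℕ.+ m)) (sym M[T+P]≡) MT+MP< ,
    subst NoTwo (sym M[T+P]≡) (NoTwo-append {k = k} MT<P noTwo noTwoM)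
    where
    P = 3 ℕ.^ k
    M[T+P]≡ : M ℕ.* (T ℕ.+ 1 ℕ.* P) ≡ M ℕ.* T ℕ.+ M ℕ.* P
    M[T+P]≡ = trans (cong (λ Q → M ℕ.* (T ℕ.+ Q)) (ℕ.*-identityˡ P)) (ℕ.*-distribˡ-+ M T P)
    MT<P : M ℕ.* T ℕ.< P
    MT<P = subst (λ e → M ℕ.* T ℕ.< 3 ℕ.^ e) (ℕ.+-identityʳ k) MT<
    MT+MP< : M ℕ.* T ℕ.+ M ℕ.* P ℕ.< 3 ℕ.^ (suc k ℕ.+ m)
    MT+MP< = begin-strict
      M ℕ.* T ℕ.+ M ℕ.* P       <⟨ ℕ.+-monoˡ-< (M ℕ.* P) MT<P ⟩
      suc M ℕ.* P               ≤⟨ ℕ.*-monoˡ-≤ P M<3ᵐ⁺¹ ⟩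
      3 ℕ.^ suc m ℕ.* P         ≡⟨ ℕ.^-distribˡ-+-* 3 (suc m) k ⟨
      3 ℕ.^ (suc m ℕ.+ k)       ≡⟨ cong (λ e → 3 ℕ.^ suc e) (ℕ.+-comm m k) ⟩
      3 ℕ.^ (suc k ℕ.+ m)       ∎
      where open ℕ.≤-Reasoning

  Sparse⇒OmitsDigit2 : ∀ {x} → Sparse m x → OmitsDigit2 (M • x)
  Sparse⇒OmitsDigit2 {x} (r , r₀≡0 , steps) j digit≡2 =
    -- Digit `j` of `M • x` is by definition digit `j` of the natural number `M * trunc x (suc j)`.
    proj₂ (product (suc j)) j (trans (sym (Fin.toℕ-fromℕ< (m%n<n (M ℕ.* trunc x (suc j) /3^ j) 3))) (cong toℕ digit≡2))
    where
    product : ∀ k → M ℕ.* trunc x k ℕ.< 3 ℕ.^ (k ℕ.+ r k) × NoTwo (M ℕ.* trunc x k)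
    product zero    rewrite ℕ.*-zeroʳ M = ℕ.m^n>0 3 (r 0) , NoTwo-0
    product (suc k) = step-product (trunc x k) k (steps k) (proj₁ (product k)) (proj₂ (product k))

Sparse⊆𝓔₂ : ∀ {x} → Sparse 1 x → x ∈ 𝓔 2
Sparse⊆𝓔₂ {x} sparse = mk↣ {to = exponent} injective , omits
  where
  exponent : Fin 2 → ℕ
  exponent 0F = 0
  exponent 1F = 2
  injective : ∀ {i j} → exponent i ≡ exponent j → i ≡ j
  injective {0F} {1F} ()
  injective {0F} {0F} _ = refl
  injective {1F} {1F} _ = refl
  omits : ∀ i → OmitsDigit2 (2 ℕ.^ exponent i • x)
  omits 0F = Sparse⇒OmitsDigit2 (ℕ.<ᵇ⇒< 1 9 tt) NoTwo-1 {x} sparse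
  omits 1F = Sparse⇒OmitsDigit2 (ℕ.<ᵇ⇒< 4 9 tt) NoTwo-4 {x} sparse

Sparse⊆𝓔₃ : ∀ {x} → Sparse 5 x → x ∈ 𝓔 3
Sparse⊆𝓔₃ {x} sparse = mk↣ {to = exponent} injective , omits
  where
  exponent : Fin 3 → ℕ
  exponent 0F = 0
  exponent 1F = 2
  exponent 2F = 8
  injective : ∀ {i j} → exponent i ≡ exponent j → i ≡ j
  injective {0F} {1F} ()
  injective {0F} {2F} ()
  injective {1F} {2F} ()
  injective {0F} {0F} _ = refl
  injective {1F} {1F} _ = refl
  injective {2F} {2F} _ = refl
  omits : ∀ i → OmitsDigit2 (2 ℕ.^ exponent i • x)
  omits 0F = Sparse⇒OmitsDigit2 (ℕ.<ᵇ⇒< 1 729 tt) NoTwo-1 {x} sparse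
  omits 1F = Sparse⇒OmitsDigit2 (ℕ.<ᵇ⇒< 4 729 tt) NoTwo-4 {x} sparse
  omits 2F = Sparse⇒OmitsDigit2 (ℕ.<ᵇ⇒< 256 729 tt) NoTwo-256 {x} sparse

-- Finite sums, cylinders and the reciprocal of the base

∑ℚ : (ℕ → ℚ) → ℕ → ℚ
∑ℚ u zero    = 0ℚ
∑ℚ u (suc N) = ∑ℚ u N ℚ.+ u N

∑ℚ-mono : ∀ {u v} → (∀ i → u i ℚ.≤ v i) → ∀ N → ∑ℚ u N ℚ.≤ ∑ℚ v N
∑ℚ-mono u≤v zero    = ℚ.≤-refl
∑ℚ-mono u≤v (suc N) = ℚ.+-mono-≤ (∑ℚ-mono u≤v N) (u≤v N)

∑ℚ-+ : ∀ u v N → ∑ℚ (λ i → u i ℚ.+ v i) N ≡ ∑ℚ u N ℚ.+ ∑ℚ v N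
∑ℚ-+ u v zero    = refl
∑ℚ-+ u v (suc N) = trans (cong (ℚ._+ (u N ℚ.+ v N)) (∑ℚ-+ u v N))
  (solve 4 (λ A B x y → A :+ B :+ (x :+ y) := A :+ x :+ (B :+ y)) refl (∑ℚ u N) (∑ℚ v N) (u N) (v N))

module _ {u : ℕ → ℚ} (0≤u : ∀ i → 0ℚ ℚ.≤ u i) where

  0≤∑ℚ : ∀ N → 0ℚ ℚ.≤ ∑ℚ u N
  0≤∑ℚ zero    = ℚ.≤-refl
  0≤∑ℚ (suc N) = 0≤p+q (0≤∑ℚ N) (0≤u N)

  ∑ℚ-extend : ∀ M N → ∑ℚ u M ℚ.≤ ∑ℚ u (N ℕ.+ M)
  ∑ℚ-extend M zero    = ℚ.≤-refl
  ∑ℚ-extend M (suc N) = ℚ.≤-trans (∑ℚ-extend M N) (p≤p+q (0≤u _) refl)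

  term≤∑ℚ : ∀ i → u i ℚ.≤ ∑ℚ u (suc i)
  term≤∑ℚ i = p≤p+q (0≤∑ℚ i) (ℚ.+-comm (u i) (∑ℚ u i))

-- This bounds the total loss allowed to the pieces of a cover; the missing tail is exactly
-- `½^(N+1)`.
∑ℚ-½ : ∀ N → ∑ℚ (λ i → ℚ.½ ^ (2 ℕ.+ i)) N ℚ.≤ ℚ.½
∑ℚ-½ N = p≤p+q (0≤^ (suc N) (ℚ.nonNegative⁻¹ ℚ.½)) (remainder N)
  where
  remainder : ∀ N → ∑ℚ (λ i → ℚ.½ ^ (2 ℕ.+ i)) N ℚ.+ ℚ.½ ^ suc N ≡ ℚ.½
  remainder zero    = refl
  remainder (suc N) = trans
    (solve 2 (λ S h → S :+ con ℚ.½ :* (con ℚ.½ :* h) :+ con ℚ.½ :* (con ℚ.½ :* h) := S :+ con ℚ.½ :* h) refl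
      (∑ℚ (λ i → ℚ.½ ^ (2 ℕ.+ i)) N) (ℚ.½ ^ N))
    (remainder N)

-- Containment in a cylinder of length `n`, put without a centre so that an empty `U` needs no
-- special case.
Agree : ℕ → Pred ℤ₃ 0ℓ → Set
Agree n U = ∀ {x y} → x ∈ U → y ∈ U → ∀ j → j ℕ.< n → x j ≡ y j

1<base : ∀ {t b} → 0ℚ ℚ.< t → 0ℚ ℚ.< b → 3^ (↥ t) ℚ.≤ b ^ ↧ₙ t → 1ℚ ℚ.< b
1<base {t} {b} 0<t 0<b 3ᵗ≤b = ℚ.≰⇒> λ b≤1 → ℚ.<-irrefl refl (begin-strict
  1ℚ                       <⟨ ι-mono-< (ℕ.^-monoʳ-< 3 (ℕ.s≤s (ℕ.s≤s ℕ.z≤n)) {0} (0<∣↥t∣ 0<t)) ⟩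
  ι (3 ℕ.^ ∣ ↥ t ∣)        ≡⟨ 3^∣↥t∣ 0<t ⟨
  3^ (↥ t)                 ≤⟨ 3ᵗ≤b ⟩
  b ^ ↧ₙ t                 ≤⟨ ^≤1 (↧ₙ t) (ℚ.<⇒≤ 0<b) b≤1 ⟩
  1ℚ                       ∎)
  where
  open ℚ.≤-Reasoning
  0<∣↥t∣ : ∀ {t} → 0ℚ ℚ.< t → 0 ℕ.< ∣ ↥ t ∣
  0<∣↥t∣ {ℚ.mkℚ (+ suc _) _ _} _ = ℕ.s≤s ℕ.z≤n
  0<∣↥t∣ {ℚ.mkℚ (+ zero) _ _}  (ℚ.*<* (ℤ.+<+ ()))
  0<∣↥t∣ {ℚ.mkℚ -[1+ _ ] _ _}  _ = ℕ.s≤s ℕ.z≤n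

module _ {a b : ℚ} (0<a : 0ℚ ℚ.< a) (ab≡1 : a ℚ.* b ≡ 1ℚ) where

  private
    0≤a = ℚ.<⇒≤ 0<a

    aⁿbⁿ≡1 : ∀ n → a ^ n ℚ.* b ^ n ≡ 1ℚ
    aⁿbⁿ≡1 n = trans (sym (^-distrib-* a b n)) (trans (cong (_^ n) ab≡1) (1^ n))

  reciprocal<1 : 1ℚ ℚ.< b → a ℚ.< 1ℚ
  reciprocal<1 1<b = subst₂ ℚ._<_ (ℚ.*-identityʳ a) ab≡1 (ℚ.*-monoʳ-<-pos a {{ℚ.positive 0<a}} 1<b)

  reciprocal-≤ : ∀ {t} → 0ℚ ℚ.< t → 3^ (↥ t) ℚ.≤ b ^ ↧ₙ t → a ^ ↧ₙ t ℚ.≤ (+ 1 / 3) ^ ∣ ↥ t ∣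
  reciprocal-≤ {t} 0<t 3ᵗ≤b = begin
    A                          ≡⟨ ℚ.*-identityʳ A ⟨
    A ℚ.* 1ℚ                   ≡⟨ cong (A ℚ.*_) 3ⁿ3⁻ⁿ≡1 ⟨
    A ℚ.* (ι 3 ^ n ℚ.* T)      ≤⟨ ℚ.*-monoˡ-≤-nonNeg A {{ℚ.nonNegative (0≤^ (↧ₙ t) 0≤a)}}
                                    (ℚ.*-monoʳ-≤-nonNeg T {{ℚ.nonNegative (0≤^ n (ℚ.nonNegative⁻¹ (+ 1 / 3)))}}
                                      (subst (ℚ._≤ b ^ ↧ₙ t) (trans (3^∣↥t∣ 0<t) (ι-^ 3 n)) 3ᵗ≤b)) ⟩
    A ℚ.* (b ^ ↧ₙ t ℚ.* T)     ≡⟨ ℚ.*-assoc A (b ^ ↧ₙ t) T ⟨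
    A ℚ.* b ^ ↧ₙ t ℚ.* T       ≡⟨ cong (ℚ._* T) (aⁿbⁿ≡1 (↧ₙ t)) ⟩
    1ℚ ℚ.* T                   ≡⟨ ℚ.*-identityˡ T ⟩
    T                          ∎
    where
    open ℚ.≤-Reasoning
    n = ∣ ↥ t ∣
    A = a ^ ↧ₙ t
    T = (+ 1 / 3) ^ n
    3ⁿ3⁻ⁿ≡1 : ι 3 ^ n ℚ.* T ≡ 1ℚ
    3ⁿ3⁻ⁿ≡1 = trans (sym (^-distrib-* (ι 3) (+ 1 / 3) n)) (1^ n)

  -- Division of `b^(m+1) ≤ b^m + 1` by `b^(m+1)`. The result says that the two continuations of a
  -- region together have at least its mass.
  reciprocal-root : ∀ m → excess m b ℚ.≤ 1ℚ → 1ℚ ℚ.≤ a ℚ.+ a ^ suc m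
  reciprocal-root m fb≤1 = begin
    1ℚ                                      ≡⟨ solve 1 (λ a → con 1ℚ := a :+ (con 1ℚ :- a)) refl a ⟩
    a ℚ.+ (1ℚ ℚ.- a)                        ≡⟨ cong (λ c → a ℚ.+ (c ℚ.- a)) ab≡1 ⟨
    a ℚ.+ (a ℚ.* b ℚ.- a)                   ≡⟨ cong (a ℚ.+_) (ℚ.*-identityˡ _) ⟨
    a ℚ.+ 1ℚ ℚ.* (a ℚ.* b ℚ.- a)            ≡⟨ cong (λ c → a ℚ.+ c ℚ.* (a ℚ.* b ℚ.- a)) (aⁿbⁿ≡1 m) ⟨
    a ℚ.+ A ℚ.* B ℚ.* (a ℚ.* b ℚ.- a)       ≡⟨ solve 4 (λ a b A B → a :+ A :* B :* (a :* b :- a) := a :+ a :* A :* (B :* (b :- con 1ℚ))) refl a b A B ⟩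
    a ℚ.+ a ^ suc m ℚ.* excess m b               ≤⟨ ℚ.+-monoʳ-≤ a (ℚ.*-monoˡ-≤-nonNeg (a ^ suc m) {{ℚ.nonNegative (0≤^ (suc m) 0≤a)}} fb≤1) ⟩
    a ℚ.+ a ^ suc m ℚ.* 1ℚ                  ≡⟨ cong (a ℚ.+_) (ℚ.*-identityʳ (a ^ suc m)) ⟩
    a ℚ.+ a ^ suc m                         ∎
    where
    open ℚ.≤-Reasoning
    A = a ^ m
    B = b ^ m

-- A sparse point outside all pieces of small total mass

module _ (em : ∀ {P : Set} → Dec P) where

  -- A region reached after reading n digits, in which the next r digits have to be 0, gets
  -- the mass a ^ (n + r).  The masses of the continuations of a region add up to at least
  -- its own, so some continuation always has more mass than the pieces meeting it.
  module MassDistribution {m : ℕ} {a : ℚ} (0<a : 0ℚ ℚ.< a) (a≤1 : a ℚ.≤ 1ℚ) (1≤a+aᵐ⁺¹ : 1ℚ ℚ.≤ a ℚ.+ a ^ suc m)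
    (U : ℕ → Pred ℤ₃ 0ℓ) (depth : ℕ → ℕ) (agree : ∀ i → Agree (depth i) (U i))
    (total<1 : ∀ N → ∑ℚ (λ i → a ^ depth i) N ℚ.< 1ℚ)
    where

    0≤a : 0ℚ ℚ.≤ a
    0≤a = ℚ.<⇒≤ 0<a

    Meets : Pred ℤ₃ 0ℓ → ℕ → Set
    Meets P i = ∃[ x ] x ∈ U i × x ∈ P

    weight : ∀ {A : Set} → Dec A → ℕ → ℚ
    weight (yes _) i = a ^ depth i
    weight (no  _) i = 0ℚ

    mass : Pred ℤ₃ 0ℓ → ℕ → ℚ
    mass P i = weight (em {Meets P i}) i

    0≤mass : ∀ P i → 0ℚ ℚ.≤ mass P i
    0≤mass P i with em {Meets P i}
    ... | yes _ = 0≤^ (depth i) 0≤a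
    ... | no  _ = ℚ.≤-refl

    mass≤ : ∀ P i → mass P i ℚ.≤ a ^ depth i
    mass≤ P i with em {Meets P i}
    ... | yes _ = ℚ.≤-refl
    ... | no  _ = 0≤^ (depth i) 0≤a

    mass-meets : ∀ P i → Meets P i → mass P i ≡ a ^ depth i
    mass-meets P i meets with em {Meets P i}
    ... | yes _     = refl
    ... | no  ¬meets = contradiction meets ¬meets

    mass-mono : ∀ {P Q} → P ⊆ Q → ∀ i → mass P i ℚ.≤ mass Q i
    mass-mono {P} {Q} P⊆Q i with em {Meets P i}
    ... | yes (x , x∈U , x∈P) = ℚ.≤-reflexive (sym (mass-meets Q i (x , x∈U , P⊆Q x∈P)))
    ... | no  _               = 0≤mass Q i

    -- Strict bounds on the partial sums stand in for the infinite sum, which may itself equal the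
    -- bound.
    Good : ℕ → ℕ → Pred ℤ₃ 0ℓ → Set
    Good n r P = ∀ N → ∑ℚ (mass P) N ℚ.< a ^ (n ℕ.+ r)

    a^[n+r]≤a^n : ∀ n r → a ^ (n ℕ.+ r) ℚ.≤ a ^ n
    a^[n+r]≤a^n n r = ^-antitone 0≤a a≤1 (ℕ.m≤m+n n r)

    -- A piece of depth at most `n` that meets the region would alone weigh at least as much as the
    -- region.
    good⇒deep : ∀ {n r P i} → Good n r P → Meets P i → n ℕ.< depth i
    good⇒deep {n} {r} {P} {i} good meets = ℕ.≰⇒> λ depth≤n → ℚ.<-irrefl refl (begin-strict
      a ^ depth i            ≡⟨ mass-meets P i meets ⟨
      mass P i               ≤⟨ term≤∑ℚ (0≤mass P) i ⟩
      ∑ℚ (mass P) (suc i)    <⟨ good (suc i) ⟩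
      a ^ (n ℕ.+ r)          ≤⟨ a^[n+r]≤a^n n r ⟩
      a ^ n                  ≤⟨ ^-antitone 0≤a a≤1 depth≤n ⟩
      a ^ depth i            ∎)
      where open ℚ.≤-Reasoning

    restrict : Pred ℤ₃ 0ℓ → ℕ → Fin 3 → Pred ℤ₃ 0ℓ
    restrict P n d x = x ∈ P × x n ≡ d

    -- Pieces meeting a good region are deeper than `n`, so their points share digit `n` and no
    -- piece is counted in both branches.
    mass-split : ∀ {n r P} → Good n r P → ∀ i →
      mass (restrict P n 0F) i ℚ.+ mass (restrict P n 1F) i ℚ.≤ mass P i
    mass-split {n} {r} {P} good i with em {Meets (restrict P n 0F) i} | em {Meets (restrict P n 1F) i}
    ... | yes (x , x∈U , x∈P , xₙ≡0) | yes (y , y∈U , _ , yₙ≡1) =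
      contradiction (trans (sym xₙ≡0) (trans (agree i x∈U y∈U n (good⇒deep {r = r} good (x , x∈U , x∈P))) yₙ≡1)) λ ()
    ... | yes (x , x∈U , x∈P , _) | no _ =
      ℚ.≤-reflexive (trans (ℚ.+-identityʳ _) (sym (mass-meets P i (x , x∈U , x∈P))))
    ... | no _ | yes (x , x∈U , x∈P , _) =
      ℚ.≤-reflexive (trans (ℚ.+-identityˡ _) (sym (mass-meets P i (x , x∈U , x∈P))))
    ... | no _ | no _ = 0≤mass P i

    good-wait : ∀ {n r P} → Good n (suc r) P → Good (suc n) r (restrict P n 0F)
    good-wait {n} {r} {P} good N = subst (λ k → ∑ℚ (mass P₀) N ℚ.< a ^ k) (ℕ.+-suc n r)
      (ℚ.≤-<-trans (∑ℚ-mono (mass-mono {P₀} {P} proj₁) N) (good N))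
      where P₀ = restrict P n 0F

    good-branch : ∀ {n P} → Good n 0 P → Good (suc n) 0 (restrict P n 0F) ⊎ Good (suc n) m (restrict P n 1F)
    good-branch {n} {P} good with em {Good (suc n) 0 (restrict P n 0F)}
    ... | yes good₀ = inj₁ good₀
    ... | no ¬good₀ = inj₂ λ N₁ → ℚ.≰⇒> λ heavy₁ → ¬good₀ λ N₀ → ℚ.≰⇒> λ heavy₀ → ℚ.<-irrefl refl (begin-strict
      a ^ (n ℕ.+ 0)                                                  ≡⟨ cong (a ^_) (ℕ.+-identityʳ n) ⟩
      a ^ n                                                          ≡⟨ ℚ.*-identityʳ (a ^ n) ⟨
      a ^ n ℚ.* 1ℚ                                                   ≤⟨ ℚ.*-monoˡ-≤-nonNeg (a ^ n) {{ℚ.nonNegative (0≤^ n 0≤a)}} 1≤a+aᵐ⁺¹ ⟩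
      a ^ n ℚ.* (a ℚ.+ a ^ suc m)                                    ≡⟨ solve 3 (λ X a Y → X :* (a :+ a :* Y) := a :* X :+ a :* (X :* Y)) refl (a ^ n) a (a ^ m) ⟩
      a ^ suc n ℚ.+ a ℚ.* (a ^ n ℚ.* a ^ m)                          ≡⟨ cong₂ (λ i X → a ^ i ℚ.+ a ℚ.* X) (sym (ℕ.+-identityʳ (suc n))) (sym (^-homo-* a n m)) ⟩
      a ^ (suc n ℕ.+ 0) ℚ.+ a ^ (suc n ℕ.+ m)                        ≤⟨ ℚ.+-mono-≤ heavy₀ heavy₁ ⟩
      -- The two branches may fail at different partial sums; masses being nonnegative, both sums
      -- can be extended to a common length.
      ∑ℚ (mass P₀) N₀ ℚ.+ ∑ℚ (mass P₁) N₁                            ≤⟨ ℚ.+-mono-≤ (∑ℚ-extend (0≤mass P₀) N₀ N₁) (∑ℚ-extend (0≤mass P₁) N₁ N₀) ⟩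
      ∑ℚ (mass P₀) (N₁ ℕ.+ N₀) ℚ.+ ∑ℚ (mass P₁) (N₀ ℕ.+ N₁)          ≡⟨ cong (λ N → ∑ℚ (mass P₀) (N₁ ℕ.+ N₀) ℚ.+ ∑ℚ (mass P₁) N) (ℕ.+-comm N₀ N₁) ⟩
      ∑ℚ (mass P₀) (N₁ ℕ.+ N₀) ℚ.+ ∑ℚ (mass P₁) (N₁ ℕ.+ N₀)          ≡⟨ ∑ℚ-+ (mass P₀) (mass P₁) (N₁ ℕ.+ N₀) ⟨
      ∑ℚ (λ i → mass P₀ i ℚ.+ mass P₁ i) (N₁ ℕ.+ N₀)                 ≤⟨ ∑ℚ-mono (mass-split {r = 0} good) (N₁ ℕ.+ N₀) ⟩
      ∑ℚ (mass P) (N₁ ℕ.+ N₀)                                        <⟨ good (N₁ ℕ.+ N₀) ⟩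
      a ^ (n ℕ.+ 0)                                                  ∎)
      where
      open ℚ.≤-Reasoning
      P₀ = restrict P n 0F
      P₁ = restrict P n 1F

    record State (n : ℕ) : Set₁ where
      constructor state
      field
        waiting : ℕ
        region  : Pred ℤ₃ 0ℓ
        good    : Good n waiting region
    open State

    record Next {n} (s : State n) : Set₁ where
      constructor next
      field
        digit     : Fin 3
        waiting′  : ℕ
        step      : Step m (waiting s) digit waiting′
        good′     : Good (suc n) waiting′ (restrict (region s) n digit)
    open Next

    advance : ∀ {n} (s : State n) → Next s
    advance (state zero    P good) = [ next 0F 0 rest , next 1F m start ]′ (good-branch good)
    advance (state (suc r) P good) = next 0F r wait (good-wait {r = r} good)

    states : ∀ n → State n
    states zero    = state 0 (λ _ → ⊤) λ N → ℚ.≤-<-trans (∑ℚ-mono (mass≤ _) N) (total<1 N)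
    states (suc n) = state (waiting′ (advance (states n))) _ (good′ (advance (states n)))

    point : ℤ₃
    point n = digit (advance (states n))

    point∈region : ∀ n → point ∈ region (states n)
    point∈region zero    = tt
    point∈region (suc n) = point∈region n , refl

    point-sparse : Sparse m point
    point-sparse = (λ n → waiting (states n)) , refl , λ n → step (advance (states n))

    -- At level `depth i` a piece containing the point meets a good region, which would make it
    -- deeper than its own depth.
    point∉U : ∀ i → ¬ (point ∈ U i)
    point∉U i x∈U = ℕ.<-irrefl refl
      (good⇒deep {r = waiting s} (good s) (point , x∈U , point∈region (depth i)))
      where s = states (depth i)

  -- From covers to Hausdorff dimension

  least : ∀ (P : ℕ → Set) {k} → P k → ∃[ n ] P n × (∀ j → j ℕ.< n → ¬ P j)
  least P {k} Pk with em {P 0}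
  ... | yes P0 = 0 , P0 , λ _ ()
  least P {zero}  P0  | no ¬P0 = contradiction P0 ¬P0
  least P {suc k} Psk | no ¬P0 with n , Psn , below ← least (P ∘ suc) Psk =
    suc n , Psn , λ { zero _ → ¬P0 ; (suc j) (ℕ.s≤s j<n) → below j j<n }

  module _ {t a : ℚ} {s : ℝ̄ 0ℓ} (0<t : 0ℚ ℚ.< t) (s≤t : s ≤ fromℚ t) (0<a : 0ℚ ℚ.< a) (a<1 : a ℚ.< 1ℚ)
    (aᵗ≤3⁻ᵗ : a ^ ↧ₙ t ℚ.≤ (+ 1 / 3) ^ ∣ ↥ t ∣) where

    private
      0≤a = ℚ.<⇒≤ 0<a
      0≤⅓ : 0ℚ ℚ.≤ + 1 / 3
      0≤⅓ = ℚ.nonNegative⁻¹ (+ 1 / 3)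
      ⅓≤1 : + 1 / 3 ℚ.≤ 1ℚ
      ⅓≤1 = ℚ.≤ᵇ⇒≤ tt

    -- The loss e only serves the pieces with at most one point, whose diameter is 0.
    piece-weight : ∀ U {e} → 0ℚ ℚ.< e → ∃[ n ] Agree n U × (a ^ n ℚ.- e) ⋖ diam U ^ʳ s
    piece-weight U {e} 0<e with em {∃[ k ] ∃[ x ] ∃[ y ] x ∈ U × y ∈ U × x k ≢ y k}
    -- The first place where two points of `U` differ determines the diameter as `3⁻ⁿ`. This base is
    -- at most 1, so the exponent `t ≥ s` is admissible in the definition of `_^ʳ_`.
    ... | yes (_ , differ) with n , (x , y , x∈U , y∈U , xₙ≢yₙ) , agree ← least (λ k → ∃[ x ] ∃[ y ] x ∈ U × y ∈ U × x k ≢ y k) differ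
      = n , (λ {x} {y} x∈U y∈U j j<n → decidable-stable (x j Fin.≟ y j) λ xⱼ≢yⱼ → agree j j<n (x , y , x∈U , y∈U , xⱼ≢yⱼ)) ,
      (a ^ n , p-q<p (a ^ n) 0<e , 0≤^ n 0≤a ,
        (+ 1 / 3) ^ n , t , 0≤^ n 0≤⅓ , 3⁻ⁿ≤diam , ℚ.<⇒≤ 0<t , inj₁ (^≤1 n 0≤⅓ ⅓≤1 , s≤t) , aⁿ≤)
      where
      3⁻ⁿ≤diam : fromℚ ((+ 1 / 3) ^ n) ≤ diam U
      3⁻ⁿ≤diam q q⋖3⁻ⁿ with p , q<p , p<3⁻ⁿ ← ℚ.<-dense (⋖-fromℚ⁻ q⋖3⁻ⁿ) =
        p , q<p , inj₂ (x , y , x∈U , y∈U , ((+ 1 / 3) ^ n , p<3⁻ⁿ , inj₂ (n , xₙ≢yₙ , refl)))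
      aⁿ≤ : (a ^ n) ^ ↧ₙ t ℚ.≤ ((+ 1 / 3) ^ n) ^ ∣ ↥ t ∣
      aⁿ≤ = begin
        (a ^ n) ^ ↧ₙ t                ≡⟨ ^-swap a n (↧ₙ t) ⟩
        (a ^ ↧ₙ t) ^ n                ≤⟨ ^-mono-≤ n (0≤^ (↧ₙ t) 0≤a) aᵗ≤3⁻ᵗ ⟩
        ((+ 1 / 3) ^ ∣ ↥ t ∣) ^ n     ≡⟨ ^-swap (+ 1 / 3) ∣ ↥ t ∣ n ⟩
        ((+ 1 / 3) ^ n) ^ ∣ ↥ t ∣     ∎
        where open ℚ.≤-Reasoning
    -- Without two distinct points `U` agrees to every depth; `n` is taken so large that `aⁿ - e` is
    -- negative, hence below any power of the diameter 0.
    piece-weight U {e} 0<e | no ¬differ with n , aⁿ<e ← ^-limit 0≤a a<1 0<e =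
      n , (λ {x} {y} x∈U y∈U j _ → decidable-stable (x j Fin.≟ y j) λ xⱼ≢yⱼ → ¬differ (j , x , y , x∈U , y∈U , xⱼ≢yⱼ)) ,
      (0ℚ , p<p+q (0<q-p aⁿ<e) (solve 2 (λ p e → p :- e :+ (e :- p) := con 0ℚ) refl (a ^ n) e) , ℚ.≤-refl ,
        0ℚ , t , ℚ.≤-refl , (λ q q⋖0 → 0ℚ , ⋖-fromℚ⁻ q⋖0 , inj₁ refl) , ℚ.<⇒≤ 0<t , inj₁ (0≤1 , s≤t) ,
        subst (ℚ._≤ 0ℚ ^ ∣ ↥ t ∣) (sym (ℚ.*-zeroˡ (0ℚ ^ ℚ.denominator-1 t))) (0≤^ ∣ ↥ t ∣ ℚ.≤-refl))

  ⋖-partialSum : ∀ {u} {g : ℕ → ℝ̄ 0ℓ} → (∀ i → u i ⋖ g i) → ∀ N {q} → q ℚ.< ∑ℚ u N → q ⋖ partialSum g N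
  ⋖-partialSum u⋖g zero    q<0 = 0ℚ , q<0 , lift refl
  ⋖-partialSum {u} u⋖g (suc N) {q} q<S with p , q<p , p<S ← ℚ.<-dense q<S =
    p , q<p , p ℚ.- u N , u N ,
    ⋖-partialSum u⋖g N (p<p+q (0<q-p p<S) (solve 3 (λ p u S → p :- u :+ (S :+ u :- p) := S) refl p (u N) (∑ℚ u N))) ,
    u⋖g N , solve 2 (λ p u → p := p :- u :+ u) refl p (u N)

  ⋖-∑ : ∀ {u} {g : ℕ → ℝ̄ 0ℓ} → (∀ i → u i ⋖ g i) → ∀ N {q} → q ℚ.< ∑ℚ u N → q ⋖ ∑ g
  ⋖-∑ u⋖g N q<S with p , q<p , p<S ← ℚ.<-dense q<S = p , q<p , N , ⋖-partialSum u⋖g N p<S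

  -- Otherwise the masses `a ^ depth i`, which exceed the `u i` by at most ½ in total, would have
  -- sums of at most ¼ + ½ < 1, and a sparse point, hence a point of `E`, would escape the cover.
  cover-bound : ∀ {m t a s δ E} → 0ℚ ℚ.< t → s ≤ fromℚ t → 0ℚ ℚ.< a → a ℚ.< 1ℚ →
    a ^ ↧ₙ t ℚ.≤ (+ 1 / 3) ^ ∣ ↥ t ∣ → 1ℚ ℚ.≤ a ℚ.+ a ^ suc m → (∀ {x} → Sparse m x → x ∈ E) →
    (C : Cover E δ) → (+ 1 / 4) ⋖ ∑ (λ i → diam (Cover.piece C i) ^ʳ s)
  cover-bound {m} {t} {a} {s} 0<t s≤t 0<a a<1 aᵗ≤3⁻ᵗ 1≤a+aᵐ⁺¹ Sparse⊆E C =
    decidable-stable em λ ¬heavy →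
      let u≤¼ : ∀ N → ∑ℚ u N ℚ.≤ + 1 / 4
          u≤¼ N = ℚ.≮⇒≥ λ ¼<u → ¬heavy (⋖-∑ {g = λ i → diam (piece i) ^ʳ s} u⋖ N ¼<u)
          open MassDistribution {m} 0<a (ℚ.<⇒≤ a<1) 1≤a+aᵐ⁺¹ piece depth agree (total<1 u≤¼)
          i , x∈Uᵢ = Cover.covers C (Sparse⊆E point-sparse)
      in point∉U i x∈Uᵢ
    where
    open Cover C using (piece)
    e : ℕ → ℚ
    e i = ℚ.½ ^ (2 ℕ.+ i)
    weights : ∀ i → ∃[ n ] Agree n (piece i) × (a ^ n ℚ.- e i) ⋖ diam (piece i) ^ʳ s
    weights i = piece-weight {s = s} 0<t s≤t 0<a a<1 aᵗ≤3⁻ᵗ (piece i) (0<^ (2 ℕ.+ i) (ℚ.positive⁻¹ ℚ.½))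
    depth : ℕ → ℕ
    depth i = proj₁ (weights i)
    agree : ∀ i → Agree (depth i) (piece i)
    agree i = proj₁ (proj₂ (weights i))
    u : ℕ → ℚ
    u i = a ^ depth i ℚ.- e i
    u⋖ : ∀ i → u i ⋖ diam (piece i) ^ʳ s
    u⋖ i = proj₂ (proj₂ (weights i))
    total<1 : (∀ N → ∑ℚ u N ℚ.≤ + 1 / 4) → ∀ N → ∑ℚ (λ i → a ^ depth i) N ℚ.< 1ℚ
    total<1 u≤¼ N = begin-strict
      ∑ℚ (λ i → a ^ depth i) N      ≤⟨ ∑ℚ-mono (λ i → ℚ.≤-reflexive (solve 2 (λ p e → p := p :- e :+ e) refl (a ^ depth i) (e i))) N ⟩
      ∑ℚ (λ i → u i ℚ.+ e i) N      ≡⟨ ∑ℚ-+ u e N ⟩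
      ∑ℚ u N ℚ.+ ∑ℚ e N             ≤⟨ ℚ.+-mono-≤ (u≤¼ N) (∑ℚ-½ N) ⟩
      + 1 / 4 ℚ.+ ℚ.½               <⟨ toWitness {a? = _ ℚ.<? _} tt ⟩
      1ℚ                            ∎
      where open ℚ.≤-Reasoning

  -- If `p`, a rational below `t`, were not below an exponent `s` of measure zero, then `s ≤ t`, and
  -- `b` would force every cover to have a sum above ¼.
  log₃-root≤dimH : ∀ {m E} → (∀ {x} → Sparse m x → x ∈ E) → log₃ (root m) ≤ dimH E
  log₃-root≤dimH {m} {E} Sparse⊆E q (t , q<t , b , 0<b , b≤root , 3ᵗ≤b)
    with p , q<p , p<t ← ℚ.<-dense q<t = p , q<p , below
    where
    below : ∀ ((s , _) : Σ[ s ∈ ℝ̄ 0ℓ ] fromℚ 0ℚ < s × s < ∞ × ℋ s E ≈ fromℚ 0ℚ) → p ⋖ s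
    below (s , (q₀ , q₀⋪0 , q₀⋖s) , _ , ℋ≤0 , _) = decidable-stable em λ p⋪s →
      -- Positivity of `s` puts a rational `q₀ ≥ 0` below `s`, and therefore below `p` and `t`.
      let 0≤q₀ = ℚ.≮⇒≥ λ q₀<0 → q₀⋪0 (⋖-fromℚ⁺ q₀<0)
          0<t = ℚ.<-trans (ℚ.≤-<-trans 0≤q₀ (ℚ.≰⇒> λ p≤q₀ → p⋪s (⋖-mono {α = s} p≤q₀ q₀⋖s))) p<t
          s≤t : s ≤ fromℚ t
          s≤t r r⋖s = ⋖-fromℚ⁺ (ℚ.<-trans (ℚ.≰⇒> λ p≤r → p⋪s (⋖-mono {α = s} p≤r r⋖s)) p<t)
          a , 0<a , ab≡1 = reciprocal 0<b
          1<b = 1<base 0<t 0<b 3ᵗ≤b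
          -- The supremum over δ and the infimum over covers each ask for a strictly larger
          -- rational, whence 1/16 < 1/8 < 1/4.
          heavy : (+ 1 / 16) ⋖ ℋ s E
          heavy = + 1 / 8 , toWitness {a? = _ ℚ.<? _} tt , (fromℚ 1ℚ , fromℚ-< {α = fromℚ 1ℚ} (⋖-fromℚ⁺ 0<1)) ,
            (+ 1 / 4 , toWitness {a? = _ ℚ.<? _} tt ,
              cover-bound {s = s} 0<t s≤t 0<a (reciprocal<1 0<a ab≡1 1<b) (reciprocal-≤ 0<a ab≡1 0<t 3ᵗ≤b)
                (reciprocal-root 0<a ab≡1 m (≤root⁻ m (ℚ.<⇒≤ 1<b) b≤root)) Sparse⊆E)
      in ℚ.<-asym (⋖-fromℚ⁻ (ℋ≤0 _ heavy)) (toWitness {a? = 0ℚ ℚ.<? + 1 / 16} tt)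

theorem5p2 : ExcludedMiddle (lsuc 0ℓ) →
    (log₃ goldenRatio ≤ dimH (𝓔 2)
    × log₃ goldenRatio ≐ + 438018 / 1000000 ± (+ 1 / 1000000))
    × (Σ[ β₁ ∈ ℝ̄ 0ℓ ]
    β₁ ^ⁿ 6 - β₁ ^ⁿ 5 - fromℚ 1ℚ ≈ fromℚ 0ℚ
    × β₁ ≐ + 128520 / 100000 ± (+ 1 / 100000)
    × log₃ β₁ ≤ dimH (𝓔 3)
    × log₃ β₁ ≐ + 228392 / 1000000 ± (+ 1 / 1000000))
theorem5p2 em =
  ((λ q q⋖ → log₃-root≤dimH em₀ {1} Sparse⊆𝓔₂ q (log₃-mono {α = goldenRatio} {root 1} golden≤root q q⋖)) , golden-log) ,
  root 5 , root-equation 5 , root-5 , log₃-root≤dimH em₀ {5} Sparse⊆𝓔₃ , root-5-log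
  where
  em₀ : {P : Set} → Dec P
  em₀ = map′ lower (lift {ℓ = lsuc 0ℓ}) em
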